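{- Let $\Sigma$ be a finite alphabet, let $n\ge 2$, let $0<\tau\le 1$, and let $\mathcal C\subseteq \Sigma^n$ be a $(2,\tau)$-LCC with zero error. Then $$|\mathcal C|\le \exp\!\left(O\!\left(\tfrac{1}{\tau^4}\cdot \log n\cdot \log|\Sigma|\right)\right),$$ where the constant in the $O(\cdot)$ is absolute.
   Context: A set $\mathcal C\subseteq\Sigma^n$ is a $(2,\tau)$-LCC with zero error if there is a randomized algorithm $\mathcal A$ such that: (1) $\mathcal A$ is given oracle access to some $z\in\Sigma^n$ and an input $i\in[n]$, and outputs a symbol of $\Sigma$ after making at most $2$ non-adaptive queries to $z$; (2) if $z\in\Sigma^n$ is $\tau$-close to some codeword $c\in\mathcal C$ (i.e. differs from $c$ in at most $\tau n$ coordinates), then for every $i\in[n]$, $\Pr[\mathcal A^z(i)=c_i]\ge 2/3$; (3) if $c\in\mathcal C$, then for every $i\in[n]$, $\Pr[\mathcal A^c(i)=c_i]=1$.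
   Formalization: The parameter τ and the probabilities with which the randomized algorithm chooses its queries and output rule are taken rational instead of real; the logarithms are rounded up to integers in base 2, which only changes the absolute constant. -}

module Defs where

open import Data.Nat as ℕ using (ℕ; zero; suc)
open import Data.Fin using (Fin)
open import Data.Fin.Properties using (_≟_)
open import Data.Vec using (Vec; lookup)
open import Data.List using (List; []; _∷_; length)
open import Data.List.Relation.Unary.All using (All)
open import Data.List.Membership.Propositional using (_∈_)
open import Data.List.Relation.Unary.Unique.Propositional using (Unique)
open import Data.Integer using (+_)
open import Data.Rational using (ℚ; _/_; 0ℚ; 1ℚ; _+_; _*_; _≤_; _<_)
open import Data.Product using (_×_; _,_; proj₁)
open import Relation.Nullary using (yes; no)
open import Relation.Binary.PropositionalEquality using (_≡_)

Word : ℕ → ℕ → Set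
Word s n = Vec (Fin s) n

⟦_⟧ : ℕ → ℚ
⟦ k ⟧ = (+ k) / 1

hamming : ∀ {s n} → Word s n → Word s n → ℕ
hamming {n = zero}  _ _ = 0
hamming {n = suc n} (x Data.Vec.∷ xs) (y Data.Vec.∷ ys) with x ≟ y
... | yes _ = hamming xs ys
... | no  _ = suc (hamming xs ys)

_close-to_within_ : ∀ {s n} → Word s n → Word s n → ℚ → Set
_close-to_within_ {n = n} z c τ = ⟦ hamming z c ⟧ ≤ τ * ⟦ n ⟧

-- A deterministic run of a non-adaptive 2-query algorithm: two query
-- positions and a function computing the output from the two answers.
-- (Making fewer than 2 queries is covered by repeating a position /
-- ignoring an answer.)
Strategy : ℕ → ℕ → Set
Strategy s n = Fin n × Fin n × (Fin s → Fin s → Fin s)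

run : ∀ {s n} → Strategy s n → Word s n → Fin s
run (a , b , f) z = f (lookup z a) (lookup z b)

-- A randomized 2-query non-adaptive algorithm, for a fixed input i, is a
-- finitely supported probability distribution over strategies,
-- given as a list of (weight , strategy).
Distribution : ℕ → ℕ → Set
Distribution s n = List (ℚ × Strategy s n)

totalWeight : ∀ {s n} → Distribution s n → ℚ
totalWeight []             = 0ℚ
totalWeight ((w , _) ∷ ds) = w + totalWeight ds

IsDistribution : ∀ {s n} → Distribution s n → Set
IsDistribution D = All (λ p → 0ℚ ≤ proj₁ p) D × totalWeight D ≡ 1ℚ

Pr : ∀ {s n} → Distribution s n → Word s n → Fin s → ℚ
Pr [] z σ = 0ℚ
Pr ((w , st) ∷ ds) z σ with run st z ≟ σ
... | yes _ = w + Pr ds z σ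
... | no  _ = Pr ds z σ

Decoder : ℕ → ℕ → Set
Decoder s n = Fin n → Distribution s n

-- C (a duplicate-free list of words, i.e. a finite subset of Σ^n) is a
-- (2,τ)-LCC with zero error, witnessed by decoder A.
record IsZeroErrorLCC {s n} (τ : ℚ) (C : List (Word s n)) (A : Decoder s n) : Set where
  field
    distr     : ∀ i → IsDistribution (A i)
    decodes   : ∀ c → c ∈ C → ∀ (z : Word s n) →
                z close-to c within τ → ∀ i → ((+ 2) / 3) ≤ Pr (A i) z (lookup c i)
    zeroError : ∀ c → c ∈ C → ∀ i →
                Pr (A i) c (lookup c i) ≡ 1ℚ

IsLCC : ∀ {s n} → ℚ → List (Word s n) → Set
IsLCC {s} {n} τ C = Data.Product.Σ (Decoder s n) (IsZeroErrorLCC τ C)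

{-# OPTIONS --safe #-}
module Submission where

open import Defs
open import Data.Nat using (ℕ; _≥_; _^_)
open import Data.Nat.Logarithm using (⌈log₂_⌉)
open import Data.List using (List; length)
open import Data.List.Relation.Unary.Unique.Propositional using (Unique)
open import Data.Rational using (ℚ; 0ℚ; 1ℚ; _*_; _<_; _≤_)
open import Data.Product using (Σ; ∃; _×_)

open import Data.Fin using (Fin; zero; suc)
import Data.Fin as Fin using (_<_; finToFun; funToFin)
import Data.Fin.Properties as Fin
open import Data.Integer using () renaming (+_ to int)
import Data.Integer as ℤ
import Data.Integer.Properties as ℤ
open import Data.List using ([]; _∷_; _++_; allFin; filter; map; tabulate)
import Data.List as List using (lookup)
open import Data.List.Membership.Propositional using (_∈_)
open import Data.List.Membership.Propositional.Properties using (∈-allFin; ∈-filter⁻; ∈-lookup)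
open import Data.List.Properties using (length-++; length-tabulate; map-tabulate)
open import Data.List.Relation.Unary.All as All using (All; []; _∷_)
import Data.List.Relation.Unary.All.Properties as All
open import Data.List.Relation.Unary.AllPairs using (_∷_)
open import Data.List.Relation.Unary.Any using (here; index; there)
open import Data.List.Relation.Unary.Any.Properties using (lookup-index)
import Data.List.Relation.Unary.Unique.Propositional.Properties as Unique
open import Data.Maybe using (Maybe; just; nothing)
open import Data.Nat using (zero; suc)
import Data.Nat as ℕ
open import Data.Nat.Induction using (<-rec)
open import Data.Nat.Logarithm using (⌈log₂⌈n/2⌉⌉≡⌈log₂n⌉∸1; ⌈log₂⌉-mono-≤; ⌈log₂2^n⌉≡n)
import Data.Nat.Properties as ℕ
import Data.Nat.Tactic.RingSolver as ℕ using (solve-∀)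
open import Data.Product using (_,_; proj₁; proj₂)
open import Data.Rational using (½; mkℚ; Positive; nonNegative; positive; toℚᵘ; _/_; _+_; _-_; -_)
open import Data.Rational.Properties
import Data.Rational.Unnormalised as ℚᵘ
import Data.Rational.Unnormalised.Properties as ℚᵘ
open import Data.Sum using (_⊎_; inj₁; inj₂)
open import Data.Vec as Vec using (lookup)
open import Data.Vec.Properties using (lookup∘tabulate; tabulate-cong; tabulate∘lookup)
open import Function using (_∘_; id)
open import Level using (0ℓ)
open import Relation.Binary.PropositionalEquality
open import Relation.Nullary using (¬_; Dec; yes; no; contradiction)
open import Relation.Nullary.Decidable using (from-yes; ¬?; _×-dec_; _→-dec_)
open import Tactic.RingSolver using (solve-∀)
open import Tactic.RingSolver.Core.AlmostCommutativeRing using (AlmostCommutativeRing; fromCommutativeRing)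

-- Zero error means that whenever coordinate i is decoded with positive probability from positions
-- a and b, the symbols c a and c b determine c i on the code.  Let 1/t ≤ τ ≤ 2/t, and call a
-- position light for i if i's decoder queries it with probability at most 2t/n.  At most n/t
-- positions are heavy, so i is still decoded with probability 2/3 when they are all blanked.
--
-- If at most 1/6 of the decoder's weight lies on light pairs, then with the heavy positions
-- blanked the decoder essentially reads one light position, and a vote over O(t log n) random
-- positions recovers c i.  A Chernoff argument by conditional expectations fixes one set R₀ of
-- positions that works simultaneously for all such i and for at least half of the codewords.
--
-- For the other coordinates i the light pairs form a fractional matching of size Ω(n/t).  Let S be
-- the set of coordinates determined by the positions chosen so far.  If many undetermined
-- coordinates have matching weight at S, one more random position determines a fraction
-- Ω(1/t²) of them.  Otherwise, on most of the complement of S, the relation "j lies in the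
-- matching of k" has large in-degrees, so weighting vertices by the number of walks leaving them
-- gives a potential that one well-chosen position multiplies by 1 + Ω(1/t); O(t log n) positions
-- then determine Ω(n/t) new coordinates.  In total O(t² log n) positions determine everything.

private variable
  A B : Set

-- Rational arithmetic

ℚ-ring : AlmostCommutativeRing 0ℓ 0ℓ
ℚ-ring = fromCommutativeRing +-*-commutativeRing zero?
  where
  zero? : ∀ x → Maybe (0ℚ ≡ x)
  zero? x with 0ℚ ≟ x
  ... | yes p = just p
  ... | no  _ = nothing

0≤1 : 0ℚ ≤ 1ℚ
0≤1 = from-yes (0ℚ ≤? 1ℚ)

*-nonneg : ∀ {p q} → 0ℚ ≤ p → 0ℚ ≤ q → 0ℚ ≤ p * q
*-nonneg {p} {q} 0≤p 0≤q = nonNegative⁻¹ (p * q)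
  {{nonNeg*nonNeg⇒nonNeg p {{nonNegative 0≤p}} q {{nonNegative 0≤q}}}}

+-nonneg : ∀ {p q} → 0ℚ ≤ p → 0ℚ ≤ q → 0ℚ ≤ p + q
+-nonneg 0≤p 0≤q = +-mono-≤ 0≤p 0≤q

*-monoˡ : ∀ {r p q} → 0ℚ ≤ r → p ≤ q → r * p ≤ r * q
*-monoˡ {r} 0≤r = *-monoˡ-≤-nonNeg r {{nonNegative 0≤r}}

*-monoʳ : ∀ {r p q} → 0ℚ ≤ r → p ≤ q → p * r ≤ q * r
*-monoʳ {r} 0≤r = *-monoʳ-≤-nonNeg r {{nonNegative 0≤r}}

*-mono : ∀ {p q r s} → 0ℚ ≤ p → 0ℚ ≤ s → p ≤ q → r ≤ s → p * r ≤ q * s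
*-mono 0≤p 0≤s p≤q r≤s = ≤-trans (*-monoˡ 0≤p r≤s) (*-monoʳ 0≤s p≤q)

diff≥0 : ∀ {p q} → p ≤ q → 0ℚ ≤ q - p
diff≥0 {p} {q} p≤q = subst (_≤ q - p) (+-inverseʳ p) (+-monoˡ-≤ (- p) p≤q)

≤-by : ∀ {p q d} → 0ℚ ≤ d → q ≡ p + d → p ≤ q
≤-by {p} {q} {d} 0≤d eq = ≤-trans (≤-reflexive (sym (+-identityʳ p)))
  (≤-trans (+-monoʳ-≤ p 0≤d) (≤-reflexive (sym eq)))

-- Opaque copies of the order decisions, so that type checking does not unfold comparisons of
-- rationals.
abstract
  _≤ᵈ_ : ∀ p q → Dec (p ≤ q)
  _≤ᵈ_ = _≤?_

  _<ᵈ_ : ∀ p q → Dec (p < q)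
  _<ᵈ_ = _<?_

  ≤-cases : ∀ p q → p ≤ q ⊎ q ≤ p
  ≤-cases = ≤-total

toℚᵘ-⟦⟧ : ∀ k → toℚᵘ ⟦ k ⟧ ℚᵘ.≃ ℚᵘ.mkℚᵘ (int k) 0
toℚᵘ-⟦⟧ k = toℚᵘ-fromℚᵘ (ℚᵘ.mkℚᵘ (int k) 0)

-- ι and recip are abstract so that normalisation does not unfold the gcd computation inside _/_.
abstract
  ι : ℕ → ℚ
  ι k = ⟦ k ⟧

  ι≡⟦⟧ : ∀ k → ι k ≡ ⟦ k ⟧
  ι≡⟦⟧ k = refl

  ι-0 : ι 0 ≡ 0ℚ
  ι-0 = refl

  ι-1 : ι 1 ≡ 1ℚ
  ι-1 = refl

  ι-+ : ∀ a b → ι (a ℕ.+ b) ≡ ι a + ι b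
  ι-+ a b = toℚᵘ-injective (ℚᵘ.≃-trans (toℚᵘ-⟦⟧ (a ℕ.+ b)) (ℚᵘ.≃-trans
    (ℚᵘ.*≡* (cong (ℤ._* (int 1)) (cong₂ ℤ._+_ (sym (ℤ.*-identityʳ (int a))) (sym (ℤ.*-identityʳ (int b))))))
    (ℚᵘ.≃-sym (ℚᵘ.≃-trans (toℚᵘ-homo-+ (ι a) (ι b)) (ℚᵘ.+-cong (toℚᵘ-⟦⟧ a) (toℚᵘ-⟦⟧ b))))))

  ι-* : ∀ a b → ι (a ℕ.* b) ≡ ι a * ι b
  ι-* a b = toℚᵘ-injective (ℚᵘ.≃-trans (toℚᵘ-⟦⟧ (a ℕ.* b)) (ℚᵘ.≃-trans
    (ℚᵘ.*≡* (cong (ℤ._* (int 1)) (ℤ.pos-* a b)))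
    (ℚᵘ.≃-sym (ℚᵘ.≃-trans (toℚᵘ-homo-* (ι a) (ι b)) (ℚᵘ.*-cong (toℚᵘ-⟦⟧ a) (toℚᵘ-⟦⟧ b))))))

  ι≥0 : ∀ k → 0ℚ ≤ ι k
  ι≥0 k = nonNegative⁻¹ (ι k) {{normalize-nonNeg k 1}}

  ι-mono : ∀ {a b} → a ℕ.≤ b → ι a ≤ ι b
  ι-mono {a} {b} a≤b = ≤-by (ι≥0 (b ℕ.∸ a))
    (trans (cong ι (sym (ℕ.m+[n∸m]≡n a≤b))) (ι-+ a (b ℕ.∸ a)))

  ι-cancel : ∀ {a b} → ι a ≤ ι b → a ℕ.≤ b
  ι-cancel {a} {b} h = ℤ.drop‿+≤+ (subst₂ ℤ._≤_ (ℤ.*-identityʳ (int a)) (ℤ.*-identityʳ (int b))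
    (ℚᵘ.drop-*≤* (ℚᵘ.≤-trans (ℚᵘ.≤-reflexive (ℚᵘ.≃-sym (toℚᵘ-⟦⟧ a)))
      (ℚᵘ.≤-trans (toℚᵘ-mono-≤ h) (ℚᵘ.≤-reflexive (toℚᵘ-⟦⟧ b))))))

  recip : (k : ℕ) → .{{ℕ.NonZero k}} → ℚ
  recip k = int 1 / k

  recip≥0 : ∀ k .{{_ : ℕ.NonZero k}} → 0ℚ ≤ recip k
  recip≥0 k = nonNegative⁻¹ (recip k) {{normalize-nonNeg 1 k}}

  ι*recip : ∀ k .{{_ : ℕ.NonZero k}} → ι k * recip k ≡ 1ℚ
  ι*recip k@(suc k-1) = toℚᵘ-injective (ℚᵘ.≃-trans (toℚᵘ-homo-* (ι k) (recip k))
    (ℚᵘ.≃-trans (ℚᵘ.*-cong (toℚᵘ-⟦⟧ k) (toℚᵘ-fromℚᵘ (ℚᵘ.mkℚᵘ (int 1) k-1)))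
      (ℚᵘ.*≡* (trans (ℤ.*-identityʳ _) (trans (ℤ.*-identityʳ (int k)) (sym (trans (ℤ.*-identityˡ _) (ℤ.*-identityˡ (int k)))))))))

  recip>0 : ∀ k .{{_ : ℕ.NonZero k}} → Positive (recip k)
  recip>0 k = normalize-pos 1 k

  -- The denominator of `τ` serves as the multiplier: the product is then the numerator, a positive
  -- integer.
  archimedean : ∀ τ → 0ℚ < τ → ∃ λ b → 1ℚ ≤ ι b * τ
  archimedean (mkℚ (ℤ.-[1+ _ ]) d _) 0<τ with positive 0<τ
  ... | ()
  archimedean (mkℚ (int zero) d _) 0<τ with positive 0<τ
  ... | ()
  archimedean τ@(mkℚ (int (suc m)) d _) 0<τ = suc d , subst (1ℚ ≤_) clear (ι-mono {1} {suc m} (ℕ.s≤s ℕ.z≤n))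
    where
    clear : ⟦ suc m ⟧ ≡ ⟦ suc d ⟧ * τ
    clear = toℚᵘ-injective (ℚᵘ.≃-trans (toℚᵘ-⟦⟧ (suc m)) (ℚᵘ.≃-trans
      (ℚᵘ.*≡* (trans (cong (int (suc m) ℤ.*_) (ℤ.*-identityˡ (int (suc d))))
        (trans (ℤ.*-comm (int (suc m)) (int (suc d))) (sym (ℤ.*-identityʳ _)))))
      (ℚᵘ.≃-sym (ℚᵘ.≃-trans (toℚᵘ-homo-* ⟦ suc d ⟧ τ) (ℚᵘ.*-cong (toℚᵘ-⟦⟧ (suc d)) ℚᵘ.≃-refl)))))

-- Powers: exponential growth and decay

pow : ℚ → ℕ → ℚ
pow p zero    = 1ℚ
pow p (suc m) = p * pow p m

pow≥0 : ∀ {p} m → 0ℚ ≤ p → 0ℚ ≤ pow p m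
pow≥0 zero    0≤p = 0≤1
pow≥0 (suc m) 0≤p = *-nonneg 0≤p (pow≥0 m 0≤p)

pow-+ : ∀ p a b → pow p (a ℕ.+ b) ≡ pow p a * pow p b
pow-+ p zero    b = sym (*-identityˡ _)
pow-+ p (suc a) b = trans (cong (p *_) (pow-+ p a b)) (sym (*-assoc p (pow p a) (pow p b)))

bernoulli : ∀ {x} m → 0ℚ ≤ x → 1ℚ + ι m * x ≤ pow (1ℚ + x) m
bernoulli {x} zero    0≤x = ≤-reflexive (cong (1ℚ +_) (trans (cong (_* x) ι-0) (*-zeroˡ x)))
bernoulli {x} (suc m) 0≤x = ≤-trans
  (≤-by (*-nonneg (ι≥0 m) (*-nonneg 0≤x 0≤x)) (trans (expand (ι m) x) (cong (λ z → 1ℚ + z * x + ι m * (x * x)) (sym (trans (ι-+ 1 m) (cong (_+ ι m) ι-1))))))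
  (*-monoˡ (+-nonneg 0≤1 0≤x) (bernoulli m 0≤x))
  where
  expand : ∀ M x → (1ℚ + x) * (1ℚ + M * x) ≡ 1ℚ + (1ℚ + M) * x + M * (x * x)
  expand = solve-∀ ℚ-ring

module _ {q : ℕ} {y : ℚ} (0≤y : 0ℚ ≤ y) (q*y≡1 : ι q * y ≡ 1ℚ) where

  -- By `bernoulli`, `q` factors `1 + y` multiply to at least `1 + q y = 2`, so every block of `q`
  -- factors buys one doubling.
  growth : ∀ m → ι (2 ℕ.^ m) ≤ pow (1ℚ + y) (m ℕ.* q)
  growth zero    = ≤-reflexive ι-1
  growth (suc m) = begin
    ι (2 ℕ.^ suc m)                             ≡⟨ ι-* 2 (2 ℕ.^ m) ⟩
    ι 2 * ι (2 ℕ.^ m)                           ≤⟨ *-mono (ι≥0 2) (pow≥0 (m ℕ.* q) (+-nonneg 0≤1 0≤y)) double (growth m) ⟩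
    pow (1ℚ + y) q * pow (1ℚ + y) (m ℕ.* q)     ≡⟨ pow-+ (1ℚ + y) q (m ℕ.* q) ⟨
    pow (1ℚ + y) (suc m ℕ.* q)                  ∎
    where
    open ≤-Reasoning
    double : ι 2 ≤ pow (1ℚ + y) q
    double = ≤-trans (≤-reflexive (trans (ι-+ 1 1) (trans (cong₂ _+_ ι-1 ι-1) (cong (1ℚ +_) (sym q*y≡1))))) (bernoulli q 0≤y)

  -- Each product `(1 + y)(1 - y) = 1 - y²` is at most 1, so the lower bound of `growth` turns into
  -- an upper bound on powers of `1 - y`.
  decay : y ≤ 1ℚ → ∀ m → ι (2 ℕ.^ m) * pow (1ℚ - y) (m ℕ.* q) ≤ 1ℚ
  decay y≤1 m = ≤-trans (*-monoʳ (pow≥0 (m ℕ.* q) 0≤1-y) (growth m)) (prod (m ℕ.* q))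
    where
    0≤1-y : 0ℚ ≤ 1ℚ - y
    0≤1-y = diff≥0 y≤1
    rearrange : ∀ a b c d → (a * b) * (c * d) ≡ (a * c) * (b * d)
    rearrange = solve-∀ ℚ-ring
    square : ∀ y → 1ℚ ≡ (1ℚ + y) * (1ℚ - y) + y * y
    square = solve-∀ ℚ-ring
    prod : ∀ k → pow (1ℚ + y) k * pow (1ℚ - y) k ≤ 1ℚ
    prod zero    = ≤-refl
    prod (suc k) = begin
      (1ℚ + y) * pow (1ℚ + y) k * ((1ℚ - y) * pow (1ℚ - y) k)    ≡⟨ rearrange (1ℚ + y) (pow (1ℚ + y) k) (1ℚ - y) (pow (1ℚ - y) k) ⟩
      (1ℚ + y) * (1ℚ - y) * (pow (1ℚ + y) k * pow (1ℚ - y) k)    ≤⟨ *-mono (*-nonneg (+-nonneg 0≤1 0≤y) 0≤1-y) 0≤1 (≤-by (*-nonneg 0≤y 0≤y) (square y)) (prod k) ⟩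
      1ℚ                                                         ∎
      where open ≤-Reasoning

recip≤1 : ∀ q .{{_ : ℕ.NonZero q}} → recip q ≤ 1ℚ
recip≤1 q@(suc q-1) = subst₂ _≤_ (trans (cong (_* recip q) ι-1) (*-identityˡ (recip q))) (ι*recip q)
  (*-monoʳ (recip≥0 q) (ι-mono {1} {q} (ℕ.s≤s ℕ.z≤n)))

ι-2 : ∀ x → ι 2 * x ≡ x + x
ι-2 x = trans (cong (_* x) (trans (ι-+ 1 1) (cong₂ _+_ ι-1 ι-1))) (double x)
  where
  double : ∀ x → (1ℚ + 1ℚ) * x ≡ x + x
  double = solve-∀ ℚ-ring

half-< : ∀ {x} → x + x ≤ 1ℚ → x < 1ℚ
half-< {x} 2x≤1 = ≰⇒> λ 1≤x → <-irrefl refl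
  (<-≤-trans (from-yes (1ℚ <? 1ℚ + 1ℚ)) (≤-trans (+-mono-≤ {1ℚ} {x} {1ℚ} {x} 1≤x 1≤x) 2x≤1))

-- Finite sums

∑ : List A → (A → ℚ) → ℚ
∑ []       f = 0ℚ
∑ (x ∷ xs) f = f x + ∑ xs f

∑-cong : ∀ (xs : List A) {f g} → (∀ x → f x ≡ g x) → ∑ xs f ≡ ∑ xs g
∑-cong []       eq = refl
∑-cong (x ∷ xs) eq = cong₂ _+_ (eq x) (∑-cong xs eq)

∑-mono-∈ : ∀ (xs : List A) {f g} → (∀ {x} → x ∈ xs → f x ≤ g x) → ∑ xs f ≤ ∑ xs g
∑-mono-∈ []       le = ≤-refl
∑-mono-∈ (x ∷ xs) le = +-mono-≤ (le (here refl)) (∑-mono-∈ xs (le ∘ there))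

∑-mono : ∀ (xs : List A) {f g} → (∀ x → f x ≤ g x) → ∑ xs f ≤ ∑ xs g
∑-mono xs le = ∑-mono-∈ xs (λ {x} _ → le x)

∑-zero : ∀ (xs : List A) → ∑ xs (λ _ → 0ℚ) ≡ 0ℚ
∑-zero []       = refl
∑-zero (x ∷ xs) = trans (+-identityˡ _) (∑-zero xs)

∑-nonneg-∈ : ∀ (xs : List A) {f} → (∀ {x} → x ∈ xs → 0ℚ ≤ f x) → 0ℚ ≤ ∑ xs f
∑-nonneg-∈ xs {f} le = subst (_≤ ∑ xs f) (∑-zero xs) (∑-mono-∈ xs le)

∑-nonneg : ∀ (xs : List A) {f} → (∀ x → 0ℚ ≤ f x) → 0ℚ ≤ ∑ xs f
∑-nonneg xs le = ∑-nonneg-∈ xs (λ {x} _ → le x)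

∑-+ : ∀ (xs : List A) f g → ∑ xs (λ x → f x + g x) ≡ ∑ xs f + ∑ xs g
∑-+ []       f g = refl
∑-+ (x ∷ xs) f g = trans (cong (f x + g x +_) (∑-+ xs f g)) (shuffle (f x) (g x) (∑ xs f) (∑ xs g))
  where
  shuffle : ∀ a b c d → a + b + (c + d) ≡ a + c + (b + d)
  shuffle = solve-∀ ℚ-ring

∑-*ˡ : ∀ (xs : List A) c f → ∑ xs (λ x → c * f x) ≡ c * ∑ xs f
∑-*ˡ []       c f = sym (*-zeroʳ c)
∑-*ˡ (x ∷ xs) c f = trans (cong (c * f x +_) (∑-*ˡ xs c f)) (sym (*-distribˡ-+ c (f x) (∑ xs f)))

∑-*ʳ : ∀ (xs : List A) c f → ∑ xs (λ x → f x * c) ≡ ∑ xs f * c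
∑-*ʳ xs c f = trans (∑-cong xs (λ x → *-comm (f x) c)) (trans (∑-*ˡ xs c f) (*-comm c (∑ xs f)))

∑-swap : ∀ (xs : List A) (ys : List B) (f : A → B → ℚ) →
         ∑ xs (λ x → ∑ ys (f x)) ≡ ∑ ys (λ y → ∑ xs (λ x → f x y))
∑-swap []       ys f = sym (∑-zero ys)
∑-swap (x ∷ xs) ys f = trans (cong (∑ ys (f x) +_) (∑-swap xs ys f))
  (sym (∑-+ ys (f x) (λ y → ∑ xs (λ x → f x y))))

∑-∈-≤ : ∀ (xs : List A) {f} → (∀ {x} → x ∈ xs → 0ℚ ≤ f x) → ∀ {x} → x ∈ xs → f x ≤ ∑ xs f
∑-∈-≤ (x ∷ xs) {f} f≥0 (here refl) = ≤-by (∑-nonneg-∈ xs (f≥0 ∘ there)) refl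
∑-∈-≤ (y ∷ xs) {f} f≥0 {x} (there x∈xs) = ≤-trans (∑-∈-≤ xs (f≥0 ∘ there) x∈xs)
  (≤-by (f≥0 (here refl)) (+-comm (f y) (∑ xs f)))

∑-cong-∈ : ∀ (xs : List A) {f g} → (∀ {x} → x ∈ xs → f x ≡ g x) → ∑ xs f ≡ ∑ xs g
∑-cong-∈ []       eq = refl
∑-cong-∈ (x ∷ xs) eq = cong₂ _+_ (eq (here refl)) (∑-cong-∈ xs (eq ∘ there))

∑-one : ∀ (xs : List A) → ∑ xs (λ _ → 1ℚ) ≡ ι (length xs)
∑-one []       = sym ι-0
∑-one (x ∷ xs) = trans (cong₂ _+_ (sym ι-1) (∑-one xs)) (sym (ι-+ 1 (length xs)))

-- If `f` exceeded `g` at every entry of the nonempty list, the sums would compare strictly the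
-- other way.
∑-pick : ∀ x (xs : List A) {f g} → ∑ (x ∷ xs) f ≤ ∑ (x ∷ xs) g → ∃ λ y → f y ≤ g y
∑-pick x xs {f} {g} le with f x ≤? g x
... | yes fx≤gx = x , fx≤gx
∑-pick x [] {f} {g} le | no fx≰gx =
  contradiction (subst₂ _≤_ (+-identityʳ (f x)) (+-identityʳ (g x)) le) fx≰gx
∑-pick x (y ∷ ys) {f} {g} le | no fx≰gx with ∑ (y ∷ ys) f ≤? ∑ (y ∷ ys) g
... | yes le′ = ∑-pick y ys le′
... | no  gt  = contradiction le (<⇒≱ (+-mono-< (≰⇒> fx≰gx) (≰⇒> gt)))
  where
  <⇒≱ : ∀ {p q} → p < q → ¬ (q ≤ p)
  <⇒≱ p<q q≤p = <-irrefl refl (<-≤-trans p<q q≤p)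

∑ᶠ : ∀ {n} → (Fin n → ℚ) → ℚ
∑ᶠ {n} = ∑ (allFin n)

∑ᶠ-suc : ∀ {n} (f : Fin (suc n) → ℚ) → ∑ᶠ f ≡ f zero + ∑ᶠ (f ∘ suc)
∑ᶠ-suc {n} f = cong (f zero +_) (trans (cong (λ xs → ∑ xs f) (sym (map-tabulate id suc))) (∑-map (allFin n)))
  where
  ∑-map : ∀ xs → ∑ (map suc xs) f ≡ ∑ xs (f ∘ suc)
  ∑-map []       = refl
  ∑-map (x ∷ xs) = cong (f (suc x) +_) (∑-map xs)

-- Indicators and point masses

𝟙 : ∀ {P : Set} → Dec P → ℚ
𝟙 (yes _) = 1ℚ
𝟙 (no _)  = 0ℚ

𝟙≥0 : ∀ {P : Set} (d : Dec P) → 0ℚ ≤ 𝟙 d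
𝟙≥0 (yes _) = 0≤1
𝟙≥0 (no _)  = ≤-refl

𝟙≤1 : ∀ {P : Set} (d : Dec P) → 𝟙 d ≤ 1ℚ
𝟙≤1 (yes _) = ≤-refl
𝟙≤1 (no _)  = 0≤1

𝟙-yes : ∀ {P : Set} (d : Dec P) → P → 𝟙 d ≡ 1ℚ
𝟙-yes (yes _) p = refl
𝟙-yes (no ¬p) p = contradiction p ¬p

𝟙-no : ∀ {P : Set} (d : Dec P) → ¬ P → 𝟙 d ≡ 0ℚ
𝟙-no (yes p) ¬p = contradiction p ¬p
𝟙-no (no _)  ¬p = refl

∑-𝟙 : ∀ {P : A → Set} (P? : ∀ x → Dec (P x)) xs → ∑ xs (λ x → 𝟙 (P? x)) ≡ ι (length (filter P? xs))
∑-𝟙 P? []       = sym ι-0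
∑-𝟙 P? (x ∷ xs) with P? x
... | yes _ = trans (cong₂ _+_ (sym ι-1) (∑-𝟙 P? xs)) (sym (ι-+ 1 (length (filter P? xs))))
... | no  _ = trans (+-identityˡ _) (∑-𝟙 P? xs)

δ : ∀ {n} → Fin n → Fin n → ℚ
δ a x = 𝟙 (a Fin.≟ x)

δ≥0 : ∀ {n} (a x : Fin n) → 0ℚ ≤ δ a x
δ≥0 a x = 𝟙≥0 (a Fin.≟ x)

∑-δ : ∀ {n} (a : Fin n) → ∑ᶠ (δ a) ≡ 1ℚ
∑-δ {suc n} zero = trans (∑ᶠ-suc {n} (δ {suc n} zero)) (trans (cong (1ℚ +_) (∑-zero (allFin n))) (+-identityʳ 1ℚ))
∑-δ {suc n} (suc a) = trans (∑ᶠ-suc (δ (suc a))) (trans (+-identityˡ _)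
  (trans (∑-cong (allFin n) δ-suc) (∑-δ a)))
  where
  δ-suc : ∀ x → δ (suc a) (suc x) ≡ δ a x
  δ-suc x with a Fin.≟ x
  ... | yes _ = refl
  ... | no  _ = refl

∑-*δ : ∀ {n} (f : Fin n → ℚ) a → ∑ᶠ (λ x → f x * δ a x) ≡ f a
∑-*δ {n} f a = trans (∑-cong (allFin n) at-a) (trans (∑-*ˡ (allFin n) (f a) (δ a)) (trans (cong (f a *_) (∑-δ a)) (*-identityʳ (f a))))
  where
  at-a : ∀ x → f x * δ a x ≡ f a * δ a x
  at-a x with a Fin.≟ x
  ... | yes refl = refl
  ... | no  _    = trans (*-zeroʳ (f x)) (sym (*-zeroʳ (f a)))

-- Averages over a uniformly random position

mean : ∀ {n} .{{_ : ℕ.NonZero n}} → (Fin n → ℚ) → ℚ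
mean {n} f = recip n * ∑ᶠ f

∑ᶠ-const : ∀ {n} c → ∑ᶠ {n} (λ _ → c) ≡ ι n * c
∑ᶠ-const {n} c = begin
  ∑ᶠ {n} (λ _ → c)       ≡⟨ ∑-cong (allFin n) (λ _ → *-identityˡ c) ⟨
  ∑ᶠ {n} (λ _ → 1ℚ * c)  ≡⟨ ∑-*ʳ (allFin n) c (λ _ → 1ℚ) ⟩
  ∑ᶠ {n} (λ _ → 1ℚ) * c  ≡⟨ cong (_* c) (∑-one (allFin n)) ⟩
  ι (length (allFin n)) * c ≡⟨ cong (λ m → ι m * c) (length-tabulate {n = n} id) ⟩
  ι n * c ∎
  where open ≡-Reasoning

module _ {n : ℕ} .{{_ : ℕ.NonZero n}} where

  private
    ν*N*c : ∀ c → recip n * (ι n * c) ≡ c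
    ν*N*c c = trans (sym (*-assoc (recip n) (ι n) c))
      (trans (cong (_* c) (trans (*-comm (recip n) (ι n)) (ι*recip n))) (*-identityˡ c))

  mean-const : ∀ c → mean {n} (λ _ → c) ≡ c
  mean-const c = trans (cong (recip n *_) (∑ᶠ-const {n} c)) (ν*N*c c)

  mean-cong : ∀ {f g : Fin n → ℚ} → (∀ x → f x ≡ g x) → mean f ≡ mean g
  mean-cong f≡g = cong (recip n *_) (∑-cong (allFin n) f≡g)

  mean-+ : ∀ (f g : Fin n → ℚ) → mean (λ x → f x + g x) ≡ mean f + mean g
  mean-+ f g = trans (cong (recip n *_) (∑-+ (allFin n) f g)) (*-distribˡ-+ (recip n) (∑ᶠ f) (∑ᶠ g))

  mean-*ˡ : ∀ c (f : Fin n → ℚ) → mean (λ x → c * f x) ≡ c * mean f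
  mean-*ˡ c f = trans (cong (recip n *_) (∑-*ˡ (allFin n) c f)) (comm₃ (recip n) c (∑ᶠ f))
    where
    comm₃ : ∀ a b d → a * (b * d) ≡ b * (a * d)
    comm₃ = solve-∀ ℚ-ring

  mean-∑ : ∀ {A : Set} (xs : List A) (f : Fin n → A → ℚ) →
           mean (λ x → ∑ xs (f x)) ≡ ∑ xs (λ y → mean (λ x → f x y))
  mean-∑ xs f = trans (cong (recip n *_) (∑-swap (allFin n) xs f))
    (sym (∑-*ˡ xs (recip n) (λ y → ∑ᶠ (λ x → f x y))))

mean-≤-pick : ∀ {n} .{{_ : ℕ.NonZero n}} {f g : Fin n → ℚ} → mean f ≤ mean g → ∃ λ x → f x ≤ g x
mean-≤-pick {suc n} {f} {g} le = ∑-pick zero (tabulate suc)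
  (*-cancelˡ-≤-pos (recip (suc n)) {{recip>0 (suc n)}} le)

-- Turns a bound on an expectation over a random position into an actual position. All greedy
-- choices below rest on this or on `pick-≤`.
pick-≥ : ∀ {n} .{{_ : ℕ.NonZero n}} {c} {f : Fin n → ℚ} → c ≤ mean f → ∃ λ x → c ≤ f x
pick-≥ {n} {c} {f} le = mean-≤-pick {n} {λ _ → c} {f} (subst (_≤ mean f) (sym (mean-const c)) le)

pick-≤ : ∀ {n} .{{_ : ℕ.NonZero n}} {c} {f : Fin n → ℚ} → mean f ≤ c → ∃ λ x → f x ≤ c
pick-≤ {n} {c} {f} le = mean-≤-pick {n} {f} {λ _ → c} (subst (mean f ≤_) (sym (mean-const c)) le)

-- Spanning sets in a closure system with dense fractional matchings

module Spanning
  {n q : ℕ} .{{_ : ℕ.NonZero n}} .{{_ : ℕ.NonZero q}}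
  (K : List (Fin n) → Fin n → Set) (K? : ∀ R k → Dec (K R k))
  (K-here : ∀ {x R} → K (x ∷ R) x) (K-there : ∀ {x R k} → K R k → K (x ∷ R) k)
  -- Intended reading: `D j k` is the degree of `j` in a fractional matching whose pairs determine
  -- `k`.
  (D : Fin n → Fin n → ℚ) (D≥0 : ∀ j k → 0ℚ ≤ D j k) (D≤ : ∀ j k → D j k ≤ recip n)
  -- With `α = 1/q`, the in-degree `4α` is spent in four parts: one on determined `j`, one on `Near`
  -- ones, one on the damping `1 - α` in `w`, and one becomes the growth factor `1 + α`.
  (D-in : ∀ {R k} → ¬ K R k → (recip q + recip q) + (recip q + recip q) ≤ ∑ᶠ (λ j → D j k))
  -- Querying the partner of a determined endpoint determines `k`, so the matching weight on
  -- determined coordinates bounds from below the chance that one random position suffices.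
  (gain : ∀ {R k} → ¬ K R k → ∑ᶠ (λ j → 𝟙 (K? R j) * D j k) ≤ mean (λ x → 𝟙 (K? (x ∷ R) k)))
  where

  private
    N α : ℚ
    N = ι n
    α = recip q

    κ : List (Fin n) → Fin n → ℚ
    κ R k = 𝟙 (K? R k)

    κ≥0 : ∀ R k → 0ℚ ≤ κ R k
    κ≥0 R k = 𝟙≥0 (K? R k)

    α≥0 : 0ℚ ≤ α
    α≥0 = recip≥0 q

    0≤1-α : 0ℚ ≤ 1ℚ - α
    0≤1-α = diff≥0 (recip≤1 q)

    infix 4 _⊴_
    _⊴_ : List (Fin n) → List (Fin n) → Set
    R ⊴ R′ = ∀ {k} → K R k → K R′ k

  -- Expansion inside a vertex set of large in-degree

  module Growth (V : Fin n → Set) (V? : ∀ k → Dec (V k))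
    (V-in : ∀ {k} → V k → α + α ≤ ∑ᶠ (λ j → 𝟙 (V? j) * D j k)) where

    χ : Fin n → ℚ
    χ k = 𝟙 (V? k)

    -- w m j counts (with weights) the walks of length at most m from j inside V.
    w : ℕ → Fin n → ℚ
    w zero    j = χ j
    w (suc m) j = (1ℚ - α) * w m j + χ j * ∑ᶠ (λ k → D j k * w m k)

    w≥0 : ∀ m j → 0ℚ ≤ w m j
    w≥0 zero    j = 𝟙≥0 (V? j)
    w≥0 (suc m) j = +-nonneg (*-nonneg 0≤1-α (w≥0 m j))
      (*-nonneg (𝟙≥0 (V? j)) (∑-nonneg (allFin n) (λ k → *-nonneg (D≥0 j k) (w≥0 m k))))

    w-outside : ∀ m {k} → ¬ V k → w m k ≡ 0ℚ
    w-outside zero    {k} ¬v = 𝟙-no (V? k) ¬v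
    w-outside (suc m) {k} ¬v = trans
      (cong₂ (λ a b → (1ℚ - α) * a + b * ∑ᶠ (λ l → D k l * w m l)) (w-outside m ¬v) (𝟙-no (V? k) ¬v))
      (vanish (1ℚ - α) (∑ᶠ (λ l → D k l * w m l)))
      where
      vanish : ∀ a b → a * 0ℚ + 0ℚ * b ≡ 0ℚ
      vanish = solve-∀ ℚ-ring

    -- After exchanging the sums, `w m k` is multiplied by `1 - α` plus the in-degree of `k` from
    -- `V`, which is at least `1 - α + 2α = 1 + α` for `k` in `V`. Off `V` the weight vanishes.
    w-total : ∀ m → pow (1ℚ + α) m * ∑ᶠ χ ≤ ∑ᶠ (w m)
    w-total zero    = ≤-reflexive (*-identityˡ _)
    w-total (suc m) = begin
      (1ℚ + α) * pow (1ℚ + α) m * ∑ᶠ χ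
        ≡⟨ *-assoc (1ℚ + α) _ _ ⟩
      (1ℚ + α) * (pow (1ℚ + α) m * ∑ᶠ χ)
        ≤⟨ *-monoˡ (+-nonneg 0≤1 α≥0) (w-total m) ⟩
      (1ℚ + α) * ∑ᶠ (w m)
        ≡⟨ ∑-*ˡ (allFin n) (1ℚ + α) (w m) ⟨
      ∑ᶠ (λ k → (1ℚ + α) * w m k)
        ≤⟨ ∑-mono (allFin n) pointwise ⟩
      ∑ᶠ (λ k → (1ℚ - α) * w m k + ∑ᶠ (λ j → χ j * D j k) * w m k)
        ≡⟨ ∑-+ (allFin n) (λ k → (1ℚ - α) * w m k) (λ k → ∑ᶠ (λ j → χ j * D j k) * w m k) ⟩
      ∑ᶠ (λ k → (1ℚ - α) * w m k) + ∑ᶠ (λ k → ∑ᶠ (λ j → χ j * D j k) * w m k)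
        ≡⟨ cong (∑ᶠ (λ k → (1ℚ - α) * w m k) +_) exchange ⟩
      ∑ᶠ (λ k → (1ℚ - α) * w m k) + ∑ᶠ (λ j → χ j * ∑ᶠ (λ k → D j k * w m k))
        ≡⟨ ∑-+ (allFin n) (λ k → (1ℚ - α) * w m k) (λ j → χ j * ∑ᶠ (λ k → D j k * w m k)) ⟨
      ∑ᶠ (w (suc m)) ∎
      where
      open ≤-Reasoning
      split : ∀ a x → (1ℚ + a) * x ≡ (1ℚ - a) * x + (a + a) * x
      split = solve-∀ ℚ-ring
      pointwise : ∀ k → (1ℚ + α) * w m k ≤ (1ℚ - α) * w m k + ∑ᶠ (λ j → χ j * D j k) * w m k
      pointwise k with V? k
      ... | yes v = ≤-trans (≤-reflexive (split α (w m k)))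
              (+-monoʳ-≤ ((1ℚ - α) * w m k) (*-monoʳ (w≥0 m k) (V-in v)))
      ... | no ¬v = subst (λ z → (1ℚ + α) * z ≤ (1ℚ - α) * z + ∑ᶠ (λ j → χ j * D j k) * z)
              (sym (w-outside m ¬v))
              (≤-reflexive (vanish (1ℚ + α) (1ℚ - α) (∑ᶠ (λ j → χ j * D j k))))
        where
        vanish : ∀ a b c → a * 0ℚ ≡ b * 0ℚ + c * 0ℚ
        vanish = solve-∀ ℚ-ring
      exchange : ∑ᶠ (λ k → ∑ᶠ (λ j → χ j * D j k) * w m k) ≡ ∑ᶠ (λ j → χ j * ∑ᶠ (λ k → D j k * w m k))
      exchange = trans (∑-cong (allFin n) (λ k → sym (∑-*ʳ (allFin n) (w m k) (λ j → χ j * D j k))))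
        (trans (∑-swap (allFin n) (allFin n) (λ k j → χ j * D j k * w m k))
        (∑-cong (allFin n) (λ j → trans (∑-cong (allFin n) (λ k → *-assoc (χ j) (D j k) (w m k)))
          (∑-*ˡ (allFin n) (χ j) (λ k → D j k * w m k)))))

    covered : List (Fin n) → ℚ
    covered R = ∑ᶠ (λ k → κ R k * χ k)

    weight : ℕ → List (Fin n) → ℚ
    weight m R = ∑ᶠ (λ k → κ R k * w m k)

    -- The damping `1 - α` is there for this bound. A determined `k` has mean 1, and since at most
    -- `α n` vertices are covered and each `D j k` is at most `1/n`, the incoming sum fits into the
    -- missing `α`. For an undetermined `k` the first term is 0 and `gain` applies.
    reached : ∀ {R} → covered R ≤ α * N → ∀ k →
              (1ℚ - α) * κ R k + ∑ᶠ (λ j → κ R j * χ j * D j k) ≤ mean (λ x → κ (x ∷ R) k)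
    reached {R} small k with K? R k
    ... | yes known = begin
      (1ℚ - α) * 1ℚ + ∑ᶠ (λ j → κ R j * χ j * D j k)
        ≤⟨ +-monoʳ-≤ ((1ℚ - α) * 1ℚ) (∑-mono (allFin n) (λ j → *-monoˡ (*-nonneg (κ≥0 R j) (𝟙≥0 (V? j))) (D≤ j k))) ⟩
      (1ℚ - α) * 1ℚ + ∑ᶠ (λ j → κ R j * χ j * recip n)
        ≡⟨ cong ((1ℚ - α) * 1ℚ +_) (∑-*ʳ (allFin n) (recip n) (λ j → κ R j * χ j)) ⟩
      (1ℚ - α) * 1ℚ + covered R * recip n
        ≤⟨ +-monoʳ-≤ ((1ℚ - α) * 1ℚ) (*-monoʳ (recip≥0 n) small) ⟩
      (1ℚ - α) * 1ℚ + α * N * recip n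
        ≡⟨ cong ((1ℚ - α) * 1ℚ +_) (trans (*-assoc α N (recip n)) (cong (α *_) (ι*recip n))) ⟩
      (1ℚ - α) * 1ℚ + α * 1ℚ
        ≡⟨ total α ⟩
      1ℚ
        ≡⟨ mean-const {n} 1ℚ ⟨
      mean {n} (λ _ → 1ℚ)
        ≡⟨ mean-cong (λ x → 𝟙-yes (K? (x ∷ R) k) (K-there known)) ⟨
      mean (λ x → κ (x ∷ R) k) ∎
      where
      open ≤-Reasoning
      total : ∀ a → (1ℚ - a) * 1ℚ + a * 1ℚ ≡ 1ℚ
      total = solve-∀ ℚ-ring
    ... | no unknown = begin
      (1ℚ - α) * 0ℚ + ∑ᶠ (λ j → κ R j * χ j * D j k)
        ≡⟨ drop (1ℚ - α) _ ⟩
      ∑ᶠ (λ j → κ R j * χ j * D j k)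
        ≤⟨ ∑-mono (allFin n) (λ j → *-monoʳ (D≥0 j k) (≤-trans (*-monoˡ (κ≥0 R j) (𝟙≤1 (V? j))) (≤-reflexive (*-identityʳ (κ R j))))) ⟩
      ∑ᶠ (λ j → κ R j * D j k)
        ≤⟨ gain unknown ⟩
      mean (λ x → κ (x ∷ R) k) ∎
      where
      open ≤-Reasoning
      drop : ∀ a b → a * 0ℚ + b ≡ b
      drop = solve-∀ ℚ-ring

    -- One walk step is traded for one position: by `reached`, the average of `weight m (x ∷ R)`
    -- over `x` is at least `weight (suc m) R`.
    step : ∀ m {R} → covered R ≤ α * N → ∃ λ x → weight (suc m) R ≤ weight m (x ∷ R)
    step m {R} small = pick-≥ {n} {weight (suc m) R} {λ x → weight m (x ∷ R)} (begin
      ∑ᶠ (λ j → κ R j * ((1ℚ - α) * w m j + χ j * ∑ᶠ (λ k → D j k * w m k)))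
        ≡⟨ ∑-cong (allFin n) (λ j → split (κ R j) (1ℚ - α) (w m j) (χ j) (∑ᶠ (λ k → D j k * w m k))) ⟩
      ∑ᶠ (λ j → (1ℚ - α) * κ R j * w m j + κ R j * χ j * ∑ᶠ (λ k → D j k * w m k))
        ≡⟨ ∑-+ (allFin n) (λ j → (1ℚ - α) * κ R j * w m j) (λ j → κ R j * χ j * ∑ᶠ (λ k → D j k * w m k)) ⟩
      ∑ᶠ (λ j → (1ℚ - α) * κ R j * w m j) + ∑ᶠ (λ j → κ R j * χ j * ∑ᶠ (λ k → D j k * w m k))
        ≡⟨ cong (∑ᶠ (λ j → (1ℚ - α) * κ R j * w m j) +_) exchange ⟩
      ∑ᶠ (λ k → (1ℚ - α) * κ R k * w m k) + ∑ᶠ (λ k → ∑ᶠ (λ j → κ R j * χ j * D j k) * w m k)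
        ≡⟨ ∑-+ (allFin n) (λ k → (1ℚ - α) * κ R k * w m k) (λ k → ∑ᶠ (λ j → κ R j * χ j * D j k) * w m k) ⟨
      ∑ᶠ (λ k → (1ℚ - α) * κ R k * w m k + ∑ᶠ (λ j → κ R j * χ j * D j k) * w m k)
        ≡⟨ ∑-cong (allFin n) (λ k → *-distribʳ-+ (w m k) ((1ℚ - α) * κ R k) _) ⟨
      ∑ᶠ (λ k → ((1ℚ - α) * κ R k + ∑ᶠ (λ j → κ R j * χ j * D j k)) * w m k)
        ≤⟨ ∑-mono (allFin n) (λ k → *-monoʳ (w≥0 m k) (reached small k)) ⟩
      ∑ᶠ (λ k → mean (λ x → κ (x ∷ R) k) * w m k)
        ≡⟨ ∑-cong (allFin n) (λ k → trans (*-comm (mean (λ x → κ (x ∷ R) k)) (w m k)) (sym (mean-*ˡ (w m k) (λ x → κ (x ∷ R) k)))) ⟩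
      ∑ᶠ (λ k → mean (λ x → w m k * κ (x ∷ R) k))
        ≡⟨ ∑-cong (allFin n) (λ k → mean-cong (λ x → *-comm (w m k) (κ (x ∷ R) k))) ⟩
      ∑ᶠ (λ k → mean (λ x → κ (x ∷ R) k * w m k))
        ≡⟨ mean-∑ (allFin n) (λ x k → κ (x ∷ R) k * w m k) ⟨
      mean (λ x → weight m (x ∷ R)) ∎)
      where
      open ≤-Reasoning
      split : ∀ k a w c s → k * (a * w + c * s) ≡ a * k * w + k * c * s
      split = solve-∀ ℚ-ring
      exchange : ∑ᶠ (λ j → κ R j * χ j * ∑ᶠ (λ k → D j k * w m k)) ≡
                 ∑ᶠ (λ k → ∑ᶠ (λ j → κ R j * χ j * D j k) * w m k)
      exchange = trans
        (∑-cong (allFin n) (λ j → trans (sym (∑-*ˡ (allFin n) (κ R j * χ j) (λ k → D j k * w m k)))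
          (∑-cong (allFin n) (λ k → sym (*-assoc (κ R j * χ j) (D j k) (w m k))))))
        (trans (∑-swap (allFin n) (allFin n) (λ j k → κ R j * χ j * D j k * w m k))
          (∑-cong (allFin n) (λ k → ∑-*ʳ (allFin n) (w m k) (λ j → κ R j * χ j * D j k))))

    Outcome : ℕ → List (Fin n) → Set
    Outcome m R = ∃ λ R′ → length R′ ℕ.≤ m ℕ.+ length R × R ⊴ R′ × α * N ≤ covered R′

    later : ∀ {m R x} → Outcome m (x ∷ R) → Outcome (suc m) R
    later {m} {R} (R′ , len , ext , done) =
      R′ , ℕ.≤-trans len (ℕ.≤-reflexive (ℕ.+-suc m (length R))) , (λ known → ext (K-there known)) , done

    -- At `m = 0` the potential `weight` is `covered` itself. Before that, either enough is covered
    -- already or `step` preserves the potential.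
    iterate : ∀ m R → α * N ≤ weight m R → Outcome m R
    iterate zero    R large = R , ℕ.≤-refl , id , large
    iterate (suc m) R large with ≤-cases (covered R) (α * N)
    ... | inj₂ big   = R , ℕ.m≤n+m (length R) (suc m) , id , big
    ... | inj₁ small = later (iterate m (proj₁ next ∷ R) (≤-trans large (proj₂ next)))
      where
      next : ∃ λ x → weight (suc m) R ≤ weight m (x ∷ R)
      next = step m small

    -- Some `j` has walk weight at least the average; once `j` is chosen it is determined, and its
    -- whole walk weight enters the potential. This seed is the extra 1 in `suc m`.
    expand : ∀ m R → α * N ≤ recip n * (pow (1ℚ + α) m * ∑ᶠ χ) → Outcome (suc m) R
    expand m R large = later (iterate m (proj₁ source ∷ R) (≤-trans (proj₂ source) (start (proj₁ source))))
      where
      source : ∃ λ j → α * N ≤ w m j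
      source = pick-≥ (≤-trans large (*-monoˡ (recip≥0 n) (w-total m)))
      start : ∀ j → w m j ≤ weight m (j ∷ R)
      start j = ≤-trans
        (≤-reflexive (sym (trans (cong (_* w m j) (𝟙-yes (K? (j ∷ R) j) K-here)) (*-identityˡ (w m j)))))
        (∑-∈-≤ (allFin n) (λ {k} _ → *-nonneg (κ≥0 (j ∷ R) k) (w≥0 m k)) (∈-allFin j))

  -- Counting undetermined coordinates

  private
    unknown : List (Fin n) → ℚ
    unknown R = ∑ᶠ (λ k → 1ℚ - κ R k)

    N≥0 : 0ℚ ≤ N
    N≥0 = ι≥0 n

    unknown≤N : ∀ R → unknown R ≤ N
    unknown≤N R = ≤-trans (∑-mono (allFin n) (λ k → ≤-by (κ≥0 R k) (cancel (κ R k))))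
      (≤-reflexive (trans (∑ᶠ-const {n} 1ℚ) (*-identityʳ N)))
      where
      cancel : ∀ x → 1ℚ ≡ 1ℚ - x + x
      cancel = solve-∀ ℚ-ring

    1-κ≥0 : ∀ R k → 0ℚ ≤ 1ℚ - κ R k
    1-κ≥0 R k = diff≥0 (𝟙≤1 (K? R k))

    unknown≥1 : ∀ {R k} → ¬ K R k → 1ℚ ≤ unknown R
    unknown≥1 {R} {k} ¬known = ≤-trans
      (≤-reflexive (cong (λ z → 1ℚ - z) (sym (𝟙-no (K? R k) ¬known))))
      (∑-∈-≤ (allFin n) (λ {j} _ → 1-κ≥0 R j) (∈-allFin k))

  -- One round: a shrinking step or a leap

  module Round (R : List (Fin n)) where

    private
      m : Fin n → ℚ
      m k = ∑ᶠ (λ j → κ R j * D j k)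

    Near Far : Fin n → Set
    Near k = ¬ K R k × α ≤ m k
    Far k = ¬ K R k × ¬ (α ≤ m k)

    Near? : ∀ k → Dec (Near k)
    Near? k = ¬? (K? R k) ×-dec (α ≤ᵈ m k)

    Far? : ∀ k → Dec (Far k)
    Far? k = ¬? (K? R k) ×-dec ¬? (α ≤ᵈ m k)

    β χ : Fin n → ℚ
    β k = 𝟙 (Near? k)
    χ k = 𝟙 (Far? k)

    partition : ∀ k → 1ℚ ≡ κ R k + β k + χ k
    partition k with K? R k | α ≤ᵈ m k
    ... | yes _ | yes _ = refl
    ... | yes _ | no  _ = refl
    ... | no  _ | yes _ = refl
    ... | no  _ | no  _ = refl

    -- A random position determines each `Near` coordinate with probability at least `α`, and these
    -- form at least an `α` fraction of the undetermined ones; hence the expected relative loss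
    -- `α²`.
    shrink : α * unknown R ≤ ∑ᶠ β → ∃ λ x → unknown (x ∷ R) ≤ (1ℚ - α * α) * unknown R
    shrink many = pick-≤ {n} {(1ℚ - α * α) * unknown R} {λ x → unknown (x ∷ R)} (begin
      mean (λ x → unknown (x ∷ R))
        ≡⟨ mean-∑ (allFin n) (λ x k → 1ℚ - κ (x ∷ R) k) ⟩
      ∑ᶠ (λ k → mean (λ x → 1ℚ - κ (x ∷ R) k))
        ≤⟨ ∑-mono (allFin n) pointwise ⟩
      ∑ᶠ (λ k → (1ℚ - κ R k) + (- α) * β k)
        ≡⟨ trans (∑-+ (allFin n) (λ k → 1ℚ - κ R k) (λ k → (- α) * β k)) (cong (unknown R +_) (∑-*ˡ (allFin n) (- α) β)) ⟩
      unknown R + (- α) * ∑ᶠ β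
        ≤⟨ ≤-by (*-nonneg α≥0 (diff≥0 many)) (rearrange α (unknown R) (∑ᶠ β)) ⟩
      (1ℚ - α * α) * unknown R ∎)
      where
      open ≤-Reasoning
      rearrange : ∀ a u b → (1ℚ - a * a) * u ≡ u + (- a) * b + a * (b - a * u)
      rearrange = solve-∀ ℚ-ring
      mean-1- : ∀ k → mean (λ x → 1ℚ - κ (x ∷ R) k) ≡ 1ℚ + (- 1ℚ) * mean (λ x → κ (x ∷ R) k)
      mean-1- k = trans (mean-cong (λ x → cong (1ℚ +_) (negate (κ (x ∷ R) k))))
        (trans (mean-+ (λ _ → 1ℚ) (λ x → (- 1ℚ) * κ (x ∷ R) k))
          (cong₂ _+_ (mean-const {n} 1ℚ) (mean-*ˡ (- 1ℚ) (λ x → κ (x ∷ R) k))))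
        where
        negate : ∀ y → - y ≡ (- 1ℚ) * y
        negate = solve-∀ ℚ-ring
      known-mean : ∀ {k} → K R k → 1ℚ + α * 0ℚ ≤ mean (λ x → κ (x ∷ R) k)
      known-mean {k} known = ≤-reflexive (trans (one α) (trans (sym (mean-const {n} 1ℚ))
        (sym (mean-cong (λ x → 𝟙-yes (K? (x ∷ R) k) (K-there known))))))
        where
        one : ∀ a → 1ℚ + a * 0ℚ ≡ 1ℚ
        one = solve-∀ ℚ-ring
      mean≥ : ∀ k → κ R k + α * β k ≤ mean (λ x → κ (x ∷ R) k)
      mean≥ k with K? R k | α ≤ᵈ m k
      ... | yes known | yes _ = known-mean known
      ... | yes known | no _  = known-mean known
      ... | no ¬known | yes large = ≤-trans (≤-reflexive (drop α)) (≤-trans large (gain ¬known))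
        where
        drop : ∀ a → 0ℚ + a * 1ℚ ≡ a
        drop = solve-∀ ℚ-ring
      ... | no ¬known | no _ = ≤-trans (≤-reflexive (zero′ α))
              (*-nonneg (recip≥0 n) (∑-nonneg (allFin n) (λ x → κ≥0 (x ∷ R) k)))
        where
        zero′ : ∀ a → 0ℚ + a * 0ℚ ≡ 0ℚ
        zero′ = solve-∀ ℚ-ring
      pointwise : ∀ k → mean (λ x → 1ℚ - κ (x ∷ R) k) ≤ (1ℚ - κ R k) + (- α) * β k
      pointwise k = ≤-trans (≤-reflexive (mean-1- k))
        (≤-by (diff≥0 (mean≥ k)) (flip (κ R k) α (β k) (mean (λ x → κ (x ∷ R) k))))
        where
        flip : ∀ k a b e → (1ℚ - k) + (- a) * b ≡ 1ℚ + (- 1ℚ) * e + (e - (k + a * b))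
        flip = solve-∀ ℚ-ring

    module _ (few : ∑ᶠ β ≤ α * unknown R) where

      -- Of the in-degree `4α`, determined coordinates carry at most `α` because `k` is `Far`, and
      -- `Near` ones at most `α` because there are at most `α n` of them with degree at most `1/n`
      -- each.
      dense : ∀ {k} → Far k → α + α ≤ ∑ᶠ (λ j → χ j * D j k)
      dense {k} (¬known , ¬large) = begin
        α + α
          ≤⟨ ≤-by (+-nonneg (+-nonneg (diff≥0 (D-in ¬known)) (diff≥0 m≤α)) (diff≥0 βD≤α))
               (rearrange α (∑ᶠ (λ j → χ j * D j k)) (∑ᶠ (λ j → D j k)) (m k) (∑ᶠ (λ j → β j * D j k)) decompose) ⟩
        ∑ᶠ (λ j → χ j * D j k) ∎
        where
        open ≤-Reasoning
        m≤α : m k ≤ α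
        m≤α = <⇒≤ (≰⇒> ¬large)
        βD≤α : ∑ᶠ (λ j → β j * D j k) ≤ α
        βD≤α = begin
          ∑ᶠ (λ j → β j * D j k)     ≤⟨ ∑-mono (allFin n) (λ j → *-monoˡ (𝟙≥0 (Near? j)) (D≤ j k)) ⟩
          ∑ᶠ (λ j → β j * recip n)   ≡⟨ ∑-*ʳ (allFin n) (recip n) β ⟩
          ∑ᶠ β * recip n             ≤⟨ *-monoʳ (recip≥0 n) (≤-trans few (*-monoˡ α≥0 (unknown≤N R))) ⟩
          α * N * recip n            ≡⟨ trans (*-assoc α N (recip n)) (trans (cong (α *_) (ι*recip n)) (*-identityʳ α)) ⟩
          α                          ∎
        decompose : ∑ᶠ (λ j → D j k) ≡ m k + ∑ᶠ (λ j → β j * D j k) + ∑ᶠ (λ j → χ j * D j k)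
        decompose = trans (∑-cong (allFin n) (λ j → trans (sym (*-identityˡ (D j k)))
            (trans (cong (_* D j k) (partition j)) (distrib (κ R j) (β j) (χ j) (D j k)))))
          (trans (∑-+ (allFin n) (λ j → κ R j * D j k + β j * D j k) (λ j → χ j * D j k))
            (cong (_+ ∑ᶠ (λ j → χ j * D j k)) (∑-+ (allFin n) (λ j → κ R j * D j k) (λ j → β j * D j k))))
          where
          distrib : ∀ a b c d → (a + b + c) * d ≡ a * d + b * d + c * d
          distrib = solve-∀ ℚ-ring
        rearrange : ∀ a c s m b → s ≡ m + b + c →
          c ≡ (a + a) + ((s - ((a + a) + (a + a))) + (a - m) + (a - b))
        rearrange a c _ m b refl = id′ a c m b
          where
          id′ : ∀ a c m b → c ≡ (a + a) + ((m + b + c - ((a + a) + (a + a))) + (a - m) + (a - b))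
          id′ = solve-∀ ℚ-ring

      open Growth Far Far? dense using (covered; expand)

      χ-total : ∀ {k} → ¬ K R k → 1ℚ - α ≤ ∑ᶠ χ
      χ-total ¬known = begin
        1ℚ - α                    ≡⟨ *-identityʳ (1ℚ - α) ⟨
        (1ℚ - α) * 1ℚ             ≤⟨ *-monoˡ 0≤1-α (unknown≥1 ¬known) ⟩
        (1ℚ - α) * unknown R      ≤⟨ ≤-by (diff≥0 few) (rearrange α (unknown R) (∑ᶠ β) (∑ᶠ χ) decompose) ⟩
        ∑ᶠ χ                      ∎
        where
        open ≤-Reasoning
        decompose : unknown R ≡ ∑ᶠ β + ∑ᶠ χ
        decompose = trans (∑-cong (allFin n) (λ k → trans (cong (_- κ R k) (partition k)) (cancel (κ R k) (β k) (χ k))))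
          (∑-+ (allFin n) β χ)
          where
          cancel : ∀ a b c → a + b + c - a ≡ b + c
          cancel = solve-∀ ℚ-ring
        rearrange : ∀ a u b c → u ≡ b + c → c ≡ (1ℚ - a) * u + (a * u - b)
        rearrange a _ b c refl = id′ a b c
          where
          id′ : ∀ a b c → c ≡ (1ℚ - a) * (b + c) + (a * (b + c) - b)
          id′ = solve-∀ ℚ-ring

      -- `expand` is applied to the `Far` coordinates. All of these were undetermined at `R`, so
      -- covering `α n` of them lowers `unknown` by as much.
      leap : ∀ T {k} → ¬ K R k → α * N ≤ recip n * (pow (1ℚ + α) T * (1ℚ - α)) →
             ∃ λ R′ → length R′ ℕ.≤ suc T ℕ.+ length R × unknown R′ ≤ unknown R - α * N
      leap T ¬known large = conclude (expand T R (≤-trans large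
          (*-monoˡ (recip≥0 n) (*-monoˡ (pow≥0 T (+-nonneg 0≤1 α≥0)) (χ-total ¬known)))))
        where
        conclude : (∃ λ R′ → length R′ ℕ.≤ suc T ℕ.+ length R × R ⊴ R′ × α * N ≤ covered R′) →
                   ∃ λ R′ → length R′ ℕ.≤ suc T ℕ.+ length R × unknown R′ ≤ unknown R - α * N
        conclude (R′ , len , ext , done) = R′ , len , (begin
          unknown R′
            ≤⟨ ∑-mono (allFin n) pointwise ⟩
          ∑ᶠ (λ k → (1ℚ - κ R k) + (- 1ℚ) * (κ R′ k * χ k))
            ≡⟨ trans (∑-+ (allFin n) (λ k → 1ℚ - κ R k) (λ k → (- 1ℚ) * (κ R′ k * χ k)))
                 (cong (unknown R +_) (∑-*ˡ (allFin n) (- 1ℚ) (λ k → κ R′ k * χ k))) ⟩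
          unknown R + (- 1ℚ) * covered R′
            ≤⟨ ≤-by (diff≥0 done) (rearrange (unknown R) (covered R′) (α * N)) ⟩
          unknown R - α * N ∎)
          where
          open ≤-Reasoning
          rearrange : ∀ u c a → u - a ≡ u + (- 1ℚ) * c + (c - a)
          rearrange = solve-∀ ℚ-ring
          κ-le : ∀ k → κ R k + κ R′ k * χ k ≤ κ R′ k
          κ-le k with K? R k | K? R′ k | α ≤ᵈ m k
          ... | yes a | no ¬b | _     = contradiction (ext a) ¬b
          ... | yes _ | yes _ | yes _ = ≤-refl
          ... | yes _ | yes _ | no _  = ≤-refl
          ... | no _  | yes _ | yes _ = from-yes (0ℚ + 1ℚ * 0ℚ ≤? 1ℚ)
          ... | no _  | yes _ | no _  = ≤-refl
          ... | no _  | no _  | yes _ = ≤-refl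
          ... | no _  | no _  | no _  = ≤-refl
          pointwise : ∀ k → 1ℚ - κ R′ k ≤ (1ℚ - κ R k) + (- 1ℚ) * (κ R′ k * χ k)
          pointwise k = ≤-by (diff≥0 (κ-le k)) (flip (κ R k) (κ R′ k) (χ k))
            where
            flip : ∀ a b c → (1ℚ - a) + (- 1ℚ) * (b * c) ≡ 1ℚ - b + (b - (a + b * c))
            flip = solve-∀ ℚ-ring

  -- Iterating the rounds

  module _ (T : ℕ) (T-large : α * N ≤ recip n * (pow (1ℚ + α) T * (1ℚ - α))) where

    Spanned : ℕ → List (Fin n) → Set
    Spanned m R = ∃ λ R′ → length R′ ℕ.≤ m ℕ.+ length R × (∀ k → K R′ k)

    private
      extend : ∀ {a b c} {R R₁ : List (Fin n)} → length R₁ ℕ.≤ a ℕ.+ length R →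
               b ℕ.+ a ℕ.≤ c → Spanned b R₁ → Spanned c R
      extend {a} {b} {c} {R} {R₁} len₁ ≤c (R′ , len , known) = R′ , (begin
        length R′                ≤⟨ len ⟩
        b ℕ.+ length R₁          ≤⟨ ℕ.+-monoʳ-≤ b len₁ ⟩
        b ℕ.+ (a ℕ.+ length R)   ≡⟨ ℕ.+-assoc b a (length R) ⟨
        b ℕ.+ a ℕ.+ length R     ≤⟨ ℕ.+-monoˡ-≤ (length R) ≤c ⟩
        c ℕ.+ length R           ∎) , known
        where open ℕ.≤-Reasoning

    -- Two budgets run down: `i` shrinking steps of one position each and `j` leaps of at most
    -- `suc T` positions each. While some coordinate is undetermined, `unknown` is at least 1, so
    -- the hypotheses keep both budgets positive.
    spanFrom : ∀ i j R → unknown R * pow (1ℚ - α * α) i < 1ℚ → unknown R ≤ ι j * (α * N) →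
               Spanned (i ℕ.+ j ℕ.* suc T) R
    spanFrom i j R u<₁ u≤₂ with Fin.all? (K? R)
    ... | yes known = R , ℕ.m≤n+m (length R) _ , known
    ... | no ¬all = search i j u<₁ u≤₂ (Fin.¬∀⟶∃¬ n (K R) (K? R) ¬all)
      where
      search : ∀ i j → unknown R * pow (1ℚ - α * α) i < 1ℚ → unknown R ≤ ι j * (α * N) →
               (∃ λ k → ¬ K R k) → Spanned (i ℕ.+ j ℕ.* suc T) R
      search zero j u< _ (_ , ¬known) =
        contradiction (≤-<-trans (unknown≥1 ¬known) (subst (_< 1ℚ) (*-identityʳ (unknown R)) u<)) (<-irrefl refl)
      search (suc i) zero _ u≤ (_ , ¬known) =
        contradiction (≤-trans (unknown≥1 ¬known) (≤-trans u≤ (≤-reflexive (trans (cong (_* (α * N)) ι-0) (*-zeroˡ (α * N))))))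
          (λ 1≤0 → <-irrefl refl (<-≤-trans (from-yes (0ℚ <? 1ℚ)) 1≤0))
      search (suc i) (suc j) u< u≤ (_ , ¬known) with ≤-cases (α * unknown R) (∑ᶠ (Round.β R))
      ... | inj₁ many = extend {1} {R = R} {R₁ = proj₁ next ∷ R} ℕ.≤-refl (ℕ.≤-reflexive (ℕ.+-comm _ 1))
              (spanFrom i (suc j) (proj₁ next ∷ R) (≤-<-trans bound u<)
                (≤-trans (proj₂ next) (≤-trans drop u≤)))
        where
        next : ∃ λ x → unknown (x ∷ R) ≤ (1ℚ - α * α) * unknown R
        next = Round.shrink R many
        0≤γ : 0ℚ ≤ 1ℚ - α * α
        0≤γ = diff≥0 (*-mono α≥0 0≤1 (recip≤1 q) (recip≤1 q))
        bound : unknown (proj₁ next ∷ R) * pow (1ℚ - α * α) i ≤ unknown R * ((1ℚ - α * α) * pow (1ℚ - α * α) i)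
        bound = ≤-trans (*-monoʳ (pow≥0 i 0≤γ) (proj₂ next))
          (≤-reflexive (trans (cong (_* pow (1ℚ - α * α) i) (*-comm (1ℚ - α * α) (unknown R))) (*-assoc (unknown R) _ _)))
        drop : (1ℚ - α * α) * unknown R ≤ unknown R
        drop = ≤-by (*-nonneg (*-nonneg α≥0 α≥0) (≤-trans 0≤1 (unknown≥1 ¬known))) (split α (unknown R))
          where
          split : ∀ a u → u ≡ (1ℚ - a * a) * u + a * a * u
          split = solve-∀ ℚ-ring
      ... | inj₂ few = extend {suc T} {R = R} {R₁ = proj₁ next} (proj₁ (proj₂ next)) (ℕ.≤-reflexive (reorder (suc i) (j ℕ.* suc T) (suc T)))
              (spanFrom (suc i) j (proj₁ next)
                (≤-<-trans (*-monoʳ (pow≥0 (suc i) 0≤γ) (≤-trans (proj₂ (proj₂ next)) smaller)) u<)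
                (≤-trans (proj₂ (proj₂ next)) (≤-by (diff≥0 u≤) (trans (minus (ι j) (α * N) (unknown R)) (cong (λ z → unknown R - α * N + (z * (α * N) - unknown R)) (sym (trans (ι-+ 1 j) (cong (_+ ι j) ι-1))))))))
        where
        next : ∃ λ R′ → length R′ ℕ.≤ suc T ℕ.+ length R × unknown R′ ≤ unknown R - α * N
        next = Round.leap R few T ¬known T-large
        0≤γ : 0ℚ ≤ 1ℚ - α * α
        0≤γ = diff≥0 (*-mono α≥0 0≤1 (recip≤1 q) (recip≤1 q))
        smaller : unknown R - α * N ≤ unknown R
        smaller = ≤-by (*-nonneg α≥0 N≥0) (cancel (unknown R) (α * N))
          where
          cancel : ∀ u a → u ≡ u - a + a
          cancel = solve-∀ ℚ-ring
        minus : ∀ j a u → j * a ≡ u - a + ((1ℚ + j) * a - u)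
        minus = solve-∀ ℚ-ring
        reorder : ∀ a b c → a ℕ.+ b ℕ.+ c ≡ a ℕ.+ (c ℕ.+ b)
        reorder a b c = trans (ℕ.+-assoc a b c) (cong (a ℕ.+_) (ℕ.+-comm b c))

  span : ∀ L → 2 ℕ.≤ q → n ℕ.≤ 2 ℕ.^ L →
         ∃ λ R → length R ℕ.≤ suc L ℕ.* (q ℕ.* q) ℕ.+ q ℕ.* suc (suc (L ℕ.+ L) ℕ.* q) × (∀ k → K R k)
  span L 2≤q n≤2^L = finish (spanFrom T T-large (suc L ℕ.* (q ℕ.* q)) q [] few-shrinks few-leaps)
    where
    open ≤-Reasoning
    T : ℕ
    -- This makes `2L + 1` doublings, so `(1 + α)^T` is at least `2 n²`: the 2 pays for the factor
    -- `1 - α ≥ 1/2`, and one `n` pays for the `1/n` of averaging.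
    T = suc (L ℕ.+ L) ℕ.* q
    N≤2^L : N ≤ ι (2 ℕ.^ L)
    N≤2^L = ι-mono n≤2^L
    2α≤1 : α + α ≤ 1ℚ
    2α≤1 = subst₂ _≤_ (ι-2 α) (ι*recip q) (*-monoʳ α≥0 (ι-mono 2≤q))
    2^-bound : ι (2 ℕ.^ suc (L ℕ.+ L)) ≡ ι (2 ℕ.^ L) * ι (2 ℕ.^ L) + ι (2 ℕ.^ L) * ι (2 ℕ.^ L)
    2^-bound = trans (ι-* 2 (2 ℕ.^ (L ℕ.+ L))) (trans (ι-2 _)
      (cong (λ z → z + z) (trans (cong ι (ℕ.^-distribˡ-+-* 2 L L)) (ι-* (2 ℕ.^ L) (2 ℕ.^ L)))))
    T-large : α * N ≤ recip n * (pow (1ℚ + α) T * (1ℚ - α))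
    T-large = begin
      α * N                              ≤⟨ *-monoʳ N≥0 (recip≤1 q) ⟩
      1ℚ * N                             ≡⟨ cong (_* N) (trans (sym (ι*recip n)) (*-comm N (recip n))) ⟩
      recip n * N * N                    ≡⟨ *-assoc (recip n) N N ⟩
      recip n * (N * N)                  ≤⟨ *-monoˡ (recip≥0 n) (begin
        N * N
          ≤⟨ ≤-by (*-nonneg (*-nonneg N≥0 N≥0) (diff≥0 2α≤1)) (expand α (N * N)) ⟩
        (N * N + N * N) * (1ℚ - α)
          ≤⟨ *-monoʳ 0≤1-α (begin
            N * N + N * N                                      ≤⟨ +-mono-≤ sq sq ⟩
            ι (2 ℕ.^ L) * ι (2 ℕ.^ L) + ι (2 ℕ.^ L) * ι (2 ℕ.^ L)  ≡⟨ 2^-bound ⟨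
            ι (2 ℕ.^ suc (L ℕ.+ L))                            ≤⟨ growth α≥0 (ι*recip q) (suc (L ℕ.+ L)) ⟩
            pow (1ℚ + α) T                                     ∎) ⟩
        pow (1ℚ + α) T * (1ℚ - α) ∎) ⟩
      recip n * (pow (1ℚ + α) T * (1ℚ - α)) ∎
      where
      sq : N * N ≤ ι (2 ℕ.^ L) * ι (2 ℕ.^ L)
      sq = *-mono N≥0 (ι≥0 (2 ℕ.^ L)) N≤2^L N≤2^L
      expand : ∀ a x → (x + x) * (1ℚ - a) ≡ x + x * (1ℚ - (a + a))
      expand = solve-∀ ℚ-ring
    Q*α² : ι (q ℕ.* q) * (α * α) ≡ 1ℚ
    Q*α² = trans (cong (_* (α * α)) (ι-* q q)) (trans (swap (ι q) α) (trans (cong₂ _*_ (ι*recip q) (ι*recip q)) refl))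
      where
      swap : ∀ a b → a * a * (b * b) ≡ (a * b) * (a * b)
      swap = solve-∀ ℚ-ring
    -- Since `q² α² = 1`, each block of `q²` shrinking steps halves the count. The block beyond the
    -- first `L` gives strictness through `half-<`.
    few-shrinks : unknown [] * pow (1ℚ - α * α) (suc L ℕ.* (q ℕ.* q)) < 1ℚ
    few-shrinks = half-< (begin
      unknown [] * P + unknown [] * P    ≤⟨ +-mono-≤ le le ⟩
      ι (2 ℕ.^ L) * P + ι (2 ℕ.^ L) * P  ≡⟨ *-distribʳ-+ P (ι (2 ℕ.^ L)) (ι (2 ℕ.^ L)) ⟨
      (ι (2 ℕ.^ L) + ι (2 ℕ.^ L)) * P    ≡⟨ cong (_* P) (trans (ι-* 2 (2 ℕ.^ L)) (ι-2 (ι (2 ℕ.^ L)))) ⟨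
      ι (2 ℕ.^ suc L) * P                ≤⟨ decay (*-nonneg α≥0 α≥0) Q*α² α²≤1 (suc L) ⟩
      1ℚ                                 ∎)
      where
      P : ℚ
      P = pow (1ℚ - α * α) (suc L ℕ.* (q ℕ.* q))
      α²≤1 : α * α ≤ 1ℚ
      α²≤1 = *-mono α≥0 0≤1 (recip≤1 q) (recip≤1 q)
      le : unknown [] * P ≤ ι (2 ℕ.^ L) * P
      le = *-monoʳ (pow≥0 (suc L ℕ.* (q ℕ.* q)) (diff≥0 α²≤1)) (≤-trans (unknown≤N []) N≤2^L)
    few-leaps : unknown [] ≤ ι q * (α * N)
    few-leaps = ≤-trans (unknown≤N []) (≤-reflexive (sym
      (trans (sym (*-assoc (ι q) α N)) (trans (cong (_* N) (ι*recip q)) (*-identityˡ N)))))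
    finish : ∀ {m} → Spanned T T-large m [] → ∃ λ R → length R ℕ.≤ m × (∀ k → K R k)
    finish {m} (R , len , known) = R , ℕ.≤-trans len (ℕ.≤-reflexive (ℕ.+-identityʳ m)) , known

-- Decoding one coordinate

weight : ∀ {s n} → ℚ × Strategy s n → ℚ
weight = proj₁

query₁ query₂ : ∀ {s n} → ℚ × Strategy s n → Fin n
query₁ (_ , a , _ , _) = a
query₂ (_ , _ , b , _) = b

output : ∀ {s n} → ℚ × Strategy s n → Word s n → Fin s
output (_ , st) = run st

totalWeight≡∑ : ∀ {s n} (E : Distribution s n) → totalWeight E ≡ ∑ E weight
totalWeight≡∑ []            = refl
totalWeight≡∑ ((w , _) ∷ E) = cong (w +_) (totalWeight≡∑ E)

Pr≡∑ : ∀ {s n} (E : Distribution s n) z σ → Pr E z σ ≡ ∑ E (λ e → weight e * 𝟙 (output e z Fin.≟ σ))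
Pr≡∑ []             z σ = refl
Pr≡∑ ((w , st) ∷ E) z σ with run st z Fin.≟ σ
... | yes _ = cong₂ _+_ (sym (*-identityʳ w)) (Pr≡∑ E z σ)
... | no  _ = trans (Pr≡∑ E z σ) (trans (sym (+-identityˡ _))
  (cong (_+ ∑ E (λ e → weight e * 𝟙 (output e z Fin.≟ σ))) (sym (*-zeroʳ w))))

hamming≤∑ : ∀ {s n} (z c : Word s n) (h : Fin n → ℚ) → (∀ j → 0ℚ ≤ h j) →
            (∀ j → lookup z j ≢ lookup c j → 1ℚ ≤ h j) → ι (hamming z c) ≤ ∑ᶠ h
hamming≤∑ {n = zero}  z c h h≥0 h≥1 = ≤-reflexive ι-0
hamming≤∑ {n = suc n} (x Vec.∷ z) (y Vec.∷ c) h h≥0 h≥1 with x Fin.≟ y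
... | yes _   = ≤-trans (hamming≤∑ z c (h ∘ suc) (h≥0 ∘ suc) (h≥1 ∘ suc))
  (≤-by (h≥0 zero) (trans (∑ᶠ-suc h) (+-comm (h zero) (∑ᶠ (h ∘ suc)))))
... | no  x≢y = ≤-trans (≤-reflexive (ι-+ 1 (hamming z c)))
  (≤-trans (+-mono-≤ (≤-trans (≤-reflexive ι-1) (h≥1 zero x≢y)) (hamming≤∑ z c (h ∘ suc) (h≥0 ∘ suc) (h≥1 ∘ suc)))
    (≤-reflexive (sym (∑ᶠ-suc h))))

-- Case distinction as a plain function of the decision, so that a decision known by an equation can
-- be replaced under `cong`.
choose : ∀ {A P : Set} → Dec P → A → A → A
choose (yes _) x y = x
choose (no _)  x y = y

private
  ⅙ ⅓ ⅔ ¼ c₀ : ℚ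
  ⅓ = int 1 / 3
  ⅙ = int 1 / 6
  ⅔ = int 2 / 3
  ¼ = int 1 / 4
  -- The gap `1/4 + 1/5` between the penalty factors of a wrong and a right vote in `u`.
  c₀ = int 9 / 20

module Coordinate
  {s n t : ℕ} .{{_ : ℕ.NonZero n}} .{{_ : ℕ.NonZero t}}
  (C : List (Word (suc s) n)) (i : Fin n) (E : Distribution (suc s) n) (E-distr : IsDistribution E)
  (E-decodes : ∀ {c} → c ∈ C → ∀ z → ι (hamming z c) * ι t ≤ ι n → ⅔ ≤ Pr E z (lookup c i))
  (E-exact : ∀ {c} → c ∈ C → Pr E c (lookup c i) ≡ 1ℚ)
  where

  private
    Run : Set
    Run = ℚ × Strategy (suc s) n

    ν N cap : ℚ
    ν = recip n
    N = ι n
    cap = (ι t + ι t) * ν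

  w≥0 : ∀ {e} → e ∈ E → 0ℚ ≤ weight e
  w≥0 e∈E = All.lookup (proj₁ E-distr) e∈E

  w-total : ∑ E weight ≡ 1ℚ
  w-total = trans (sym (totalWeight≡∑ E)) (proj₂ E-distr)

  -- The missed weights are nonnegative and add up to `1 - 1 = 0`, so each one vanishes. Zero error
  -- enters the argument only here.
  exact : ∀ {c} → c ∈ C → ∀ {e} → e ∈ E → weight e ≡ 0ℚ ⊎ output e c ≡ lookup c i
  exact {c} c∈C {e} e∈E = decide (output e c Fin.≟ lookup c i) refl
    where
    miss : Run → ℚ
    miss e = weight e * (1ℚ - 𝟙 (output e c Fin.≟ lookup c i))
    miss≥0 : ∀ {e} → e ∈ E → 0ℚ ≤ miss e
    miss≥0 {e} e∈E = *-nonneg (w≥0 e∈E) (diff≥0 (𝟙≤1 (output e c Fin.≟ lookup c i)))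
    miss-total : ∑ E miss ≡ 0ℚ
    miss-total = trans (∑-cong E (λ e → expand (weight e) (𝟙 (output e c Fin.≟ lookup c i))))
      (trans (∑-+ E weight (λ e → (- 1ℚ) * (weight e * 𝟙 (output e c Fin.≟ lookup c i))))
      (cong₂ _+_ w-total (trans (∑-*ˡ E (- 1ℚ) (λ e → weight e * 𝟙 (output e c Fin.≟ lookup c i)))
        (cong ((- 1ℚ) *_) (trans (sym (Pr≡∑ E c (lookup c i))) (E-exact c∈C))))))
      where
      expand : ∀ w o → w * (1ℚ - o) ≡ w + (- 1ℚ) * (w * o)
      expand = solve-∀ ℚ-ring
    miss-zero : miss e ≡ 0ℚ
    miss-zero = ≤-antisym (≤-trans (∑-∈-≤ E miss≥0 e∈E) (≤-reflexive miss-total)) (miss≥0 e∈E)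
    decide : (d : Dec (output e c ≡ lookup c i)) → d ≡ (output e c Fin.≟ lookup c i) → weight e ≡ 0ℚ ⊎ output e c ≡ lookup c i
    decide (yes eq) _  = inj₂ eq
    decide (no neq) eq = inj₁ (trans (sym (all (weight e)))
      (trans (cong (λ d → weight e * (1ℚ - 𝟙 d)) eq) miss-zero))
      where
      all : ∀ w → w * (1ℚ - 0ℚ) ≡ w
      all = solve-∀ ℚ-ring

  -- Heavy and light positions

  load : Fin n → ℚ
  load j = ∑ E (λ e → weight e * (δ (query₁ e) j + δ (query₂ e) j))

  load≥0 : ∀ j → 0ℚ ≤ load j
  load≥0 j = ∑-nonneg-∈ E (λ {e} e∈E → *-nonneg (w≥0 e∈E) (+-nonneg (δ≥0 (query₁ e) j) (δ≥0 (query₂ e) j)))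

  load-total : ∑ᶠ load ≡ 1ℚ + 1ℚ
  load-total = begin
    ∑ᶠ load
      ≡⟨ ∑-swap (allFin n) E (λ j e → weight e * (δ (query₁ e) j + δ (query₂ e) j)) ⟩
    ∑ E (λ e → ∑ᶠ (λ j → weight e * (δ (query₁ e) j + δ (query₂ e) j)))
      ≡⟨ ∑-cong E (λ e → trans (∑-*ˡ (allFin n) (weight e) (λ j → δ (query₁ e) j + δ (query₂ e) j))
           (cong (weight e *_) (trans (∑-+ (allFin n) (δ (query₁ e)) (δ (query₂ e))) (cong₂ _+_ (∑-δ (query₁ e)) (∑-δ (query₂ e)))))) ⟩
    ∑ E (λ e → weight e * (1ℚ + 1ℚ))
      ≡⟨ trans (∑-*ʳ E (1ℚ + 1ℚ) weight) (cong (_* (1ℚ + 1ℚ)) w-total) ⟩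
    1ℚ + 1ℚ ∎
    where open ≡-Reasoning

  Light : Fin n → Set
  Light j = load j ≤ cap

  light? : ∀ j → Dec (Light j)
  light? j = load j ≤ᵈ cap

  l : Fin n → ℚ
  l j = 𝟙 (light? j)

  cap≥0 : 0ℚ ≤ cap
  cap≥0 = *-nonneg (+-nonneg (ι≥0 t) (ι≥0 t)) (recip≥0 n)

  -- Markov's inequality: the loads add up to 2, two queries per run, and a heavy position carries
  -- more than `2t/n`.
  heavy-total : ∑ᶠ (λ j → 1ℚ - l j) * ι t ≤ N
  heavy-total = *-cancelˡ-≤-pos (ν + ν) {{pos+pos⇒pos ν {{recip>0 n}} ν {{recip>0 n}}}} (begin
    (ν + ν) * (∑ᶠ (λ j → 1ℚ - l j) * ι t)   ≡⟨ regroup ν (∑ᶠ (λ j → 1ℚ - l j)) (ι t) ⟩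
    ∑ᶠ (λ j → 1ℚ - l j) * cap               ≡⟨ ∑-*ʳ (allFin n) cap (λ j → 1ℚ - l j) ⟨
    ∑ᶠ (λ j → (1ℚ - l j) * cap)             ≤⟨ ∑-mono (allFin n) (λ j → pointwise j (light? j)) ⟩
    ∑ᶠ load                                 ≡⟨ load-total ⟩
    1ℚ + 1ℚ                                 ≡⟨ cong₂ _+_ (ι*recip n) (ι*recip n) ⟨
    N * ν + N * ν                           ≡⟨ double N ν ⟩
    (ν + ν) * N                             ∎)
    where
    open ≤-Reasoning
    regroup : ∀ v h t → (v + v) * (h * t) ≡ h * ((t + t) * v)
    regroup = solve-∀ ℚ-ring
    double : ∀ m v → m * v + m * v ≡ (v + v) * m
    double = solve-∀ ℚ-ring
    pointwise : ∀ j (d : Dec (Light j)) → (1ℚ - 𝟙 d) * cap ≤ load j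
    pointwise j (yes _) = ≤-trans (≤-reflexive (*-zeroˡ cap)) (load≥0 j)
    pointwise j (no gt) = ≤-trans (≤-reflexive (*-identityˡ cap)) (<⇒≤ (≰⇒> gt))

  blank : Word (suc s) n → Fin n → Fin (suc s)
  blank c j = choose (light? j) (lookup c j) zero

  blanked : Word (suc s) n → Word (suc s) n
  blanked c = Vec.tabulate (blank c)

  hit : Word (suc s) n → Run → ℚ
  hit c e = 𝟙 (output e (blanked c) Fin.≟ lookup c i)

  -- Blanking alters only heavy positions, at most `n/t` of them, so the blanked word stays within
  -- the decoding radius of `c`.
  hits : ∀ {c} → c ∈ C → ⅔ ≤ ∑ E (λ e → weight e * hit c e)
  hits {c} c∈C = subst (⅔ ≤_) (Pr≡∑ E (blanked c) (lookup c i)) (E-decodes c∈C (blanked c)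
    (≤-trans (*-monoʳ (ι≥0 t) (hamming≤∑ (blanked c) c (λ j → 1ℚ - l j) (λ j → diff≥0 (𝟙≤1 (light? j))) (λ j → differ j (light? j) refl)))
      heavy-total))
    where
    differ : ∀ j (d : Dec (Light j)) → d ≡ light? j → lookup (blanked c) j ≢ lookup c j → 1ℚ ≤ 1ℚ - 𝟙 (light? j)
    differ j (yes _) eq neq = contradiction (trans (lookup∘tabulate (blank c) j) (cong (λ d → choose d (lookup c j) zero) (sym eq))) neq
    differ j (no _)  eq neq = ≤-reflexive (cong (λ d → 1ℚ - 𝟙 d) eq)

  both : Run → ℚ
  both e = l (query₁ e) * l (query₂ e)

  lightPairs : ℚ
  lightPairs = ∑ E (λ e → weight e * both e)

  l≥0 : ∀ j → 0ℚ ≤ l j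
  l≥0 j = 𝟙≥0 (light? j)

  1-l≥0 : ∀ j → 0ℚ ≤ 1ℚ - l j
  1-l≥0 j = diff≥0 (𝟙≤1 (light? j))

  lightLoad : Fin n → ℚ
  lightLoad x = ∑ E (λ e → weight e * (l (query₁ e) * δ (query₁ e) x + l (query₂ e) * δ (query₂ e) x))

  -- A heavy `x` is never charged, and a light `x` is charged at most its `load`.
  lightLoad≤cap : ∀ x → lightLoad x ≤ cap
  lightLoad≤cap x = bound (light? x) refl
    where
    bound : (d : Dec (Light x)) → d ≡ light? x → lightLoad x ≤ cap
    bound (yes light) _ = ≤-trans (∑-mono-∈ E (λ {e} e∈E → *-monoˡ (w≥0 e∈E)
        (+-mono-≤ (drop (query₁ e)) (drop (query₂ e))))) light
      where
      drop : ∀ a → l a * δ a x ≤ δ a x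
      drop a = ≤-trans (*-monoʳ (δ≥0 a x) (𝟙≤1 (light? a))) (≤-reflexive (*-identityˡ (δ a x)))
    bound (no heavy) eq = ≤-trans (≤-reflexive (trans (∑-cong E vanish) (∑-zero E))) cap≥0
      where
      zeros : ∀ a → l a * δ a x ≡ 0ℚ
      zeros a with a Fin.≟ x
      ... | yes refl = cong (λ d → 𝟙 d * 1ℚ) (sym eq)
      ... | no _     = *-zeroʳ (l a)
      vanish : ∀ e → weight e * (l (query₁ e) * δ (query₁ e) x + l (query₂ e) * δ (query₂ e) x) ≡ 0ℚ
      vanish e = trans (cong (weight e *_) (cong₂ _+_ (zeros (query₁ e)) (zeros (query₂ e)))) (*-zeroʳ (weight e))

  private
    ρ : ℚ
    ρ = recip t

    t*ρ≡1 : ι t * ρ ≡ 1ℚ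
    t*ρ≡1 = ι*recip t

  -- The fractional matching of light pairs

  degree : Fin n → ℚ
  degree j = ∑ E (λ e → weight e * both e * (δ (query₁ e) j + δ (query₂ e) j))

  both≥0 : ∀ e → 0ℚ ≤ both e
  both≥0 e = *-nonneg (l≥0 (query₁ e)) (l≥0 (query₂ e))

  w*both≥0 : ∀ {e} → e ∈ E → 0ℚ ≤ weight e * both e
  w*both≥0 {e} e∈E = *-nonneg (w≥0 e∈E) (both≥0 e)

  degree≥0 : ∀ j → 0ℚ ≤ degree j
  degree≥0 j = ∑-nonneg-∈ E (λ {e} e∈E → *-nonneg (w*both≥0 e∈E) (+-nonneg (δ≥0 (query₁ e) j) (δ≥0 (query₂ e) j)))

  degree≤cap : ∀ j → degree j ≤ cap
  degree≤cap j = ≤-trans (∑-mono-∈ E λ {e} e∈E → ≤-trans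
      (≤-reflexive (*-assoc (weight e) (both e) (δ (query₁ e) j + δ (query₂ e) j)))
      (*-monoˡ (w≥0 e∈E) (≤-trans
        (≤-reflexive (*-distribˡ-+ (both e) (δ (query₁ e) j) (δ (query₂ e) j)))
        (+-mono-≤ (*-monoʳ (δ≥0 (query₁ e) j) (both≤₁ e)) (*-monoʳ (δ≥0 (query₂ e) j) (both≤₂ e))))))
    (lightLoad≤cap j)
    where
    both≤₁ : ∀ e → both e ≤ l (query₁ e)
    both≤₁ e = ≤-trans (*-monoˡ (l≥0 (query₁ e)) (𝟙≤1 (light? (query₂ e)))) (≤-reflexive (*-identityʳ _))
    both≤₂ : ∀ e → both e ≤ l (query₂ e)
    both≤₂ e = ≤-trans (*-monoʳ (l≥0 (query₂ e)) (𝟙≤1 (light? (query₁ e)))) (≤-reflexive (*-identityˡ _))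

  -- The light pairs, rescaled to a fractional matching of [n] in which every vertex has degree at most 1/n.
  D : Fin n → ℚ
  D j = ½ * ρ * degree j

  private
    ½ρ≥0 : 0ℚ ≤ ½ * ρ
    ½ρ≥0 = *-nonneg (from-yes (0ℚ ≤? ½)) (recip≥0 t)

    ½ρ*cap : ½ * ρ * cap ≡ ν
    ½ρ*cap = trans (regroup (ι t) ρ ν) (trans (cong (_* ν) t*ρ≡1) (*-identityˡ ν))
      where
      regroup : ∀ t r v → ½ * r * ((t + t) * v) ≡ t * r * v
      regroup = solve-∀ ℚ-ring

  D≥0 : ∀ j → 0ℚ ≤ D j
  D≥0 j = *-nonneg ½ρ≥0 (degree≥0 j)

  D≤ν : ∀ j → D j ≤ ν
  D≤ν j = ≤-trans (*-monoˡ ½ρ≥0 (degree≤cap j)) (≤-reflexive ½ρ*cap)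

  module _ (f : Fin n → ℚ) where

    ∑-*degree : ∑ᶠ (λ j → f j * degree j) ≡ ∑ E (λ e → weight e * both e * (f (query₁ e) + f (query₂ e)))
    ∑-*degree = begin
      ∑ᶠ (λ j → f j * degree j)
        ≡⟨ ∑-cong (allFin n) (λ j → sym (∑-*ˡ E (f j) (λ e → weight e * both e * (δ (query₁ e) j + δ (query₂ e) j)))) ⟩
      ∑ᶠ (λ j → ∑ E (λ e → f j * (weight e * both e * (δ (query₁ e) j + δ (query₂ e) j))))
        ≡⟨ ∑-swap (allFin n) E (λ j e → f j * (weight e * both e * (δ (query₁ e) j + δ (query₂ e) j))) ⟩
      ∑ E (λ e → ∑ᶠ (λ j → f j * (weight e * both e * (δ (query₁ e) j + δ (query₂ e) j))))
        ≡⟨ ∑-cong E inner ⟩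
      ∑ E (λ e → weight e * both e * (f (query₁ e) + f (query₂ e))) ∎
      where
      open ≡-Reasoning
      regroup : ∀ f w a b → f * (w * (a + b)) ≡ w * (f * a + f * b)
      regroup = solve-∀ ℚ-ring
      inner : ∀ e → ∑ᶠ (λ j → f j * (weight e * both e * (δ (query₁ e) j + δ (query₂ e) j))) ≡
                    weight e * both e * (f (query₁ e) + f (query₂ e))
      inner e = trans (∑-cong (allFin n) (λ j → regroup (f j) (weight e * both e) (δ (query₁ e) j) (δ (query₂ e) j)))
        (trans (∑-*ˡ (allFin n) (weight e * both e) (λ j → f j * δ (query₁ e) j + f j * δ (query₂ e) j))
        (cong (weight e * both e *_) (trans (∑-+ (allFin n) (λ j → f j * δ (query₁ e) j) (λ j → f j * δ (query₂ e) j))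
          (cong₂ _+_ (∑-*δ f (query₁ e)) (∑-*δ f (query₂ e))))))

    ∑-*D : ∑ᶠ (λ j → f j * D j) ≡ ½ * ρ * ∑ E (λ e → weight e * both e * (f (query₁ e) + f (query₂ e)))
    ∑-*D = trans (∑-cong (allFin n) (λ j → regroup (f j) (½ * ρ) (degree j)))
      (trans (∑-*ˡ (allFin n) (½ * ρ) (λ j → f j * degree j)) (cong (½ * ρ *_) ∑-*degree))
      where
      regroup : ∀ f a d → f * (a * d) ≡ a * (f * d)
      regroup = solve-∀ ℚ-ring

  D-total : ∑ᶠ D ≡ ρ * lightPairs
  D-total = begin
    ∑ᶠ D                                                   ≡⟨ ∑-cong (allFin n) (λ j → *-identityˡ (D j)) ⟨
    ∑ᶠ (λ j → 1ℚ * D j)                                    ≡⟨ ∑-*D (λ _ → 1ℚ) ⟩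
    ½ * ρ * ∑ E (λ e → weight e * both e * (1ℚ + 1ℚ))      ≡⟨ cong (½ * ρ *_) (∑-*ʳ E (1ℚ + 1ℚ) (λ e → weight e * both e)) ⟩
    ½ * ρ * (lightPairs * (1ℚ + 1ℚ))                       ≡⟨ regroup ρ lightPairs ⟩
    ρ * lightPairs                                         ∎
    where
    open ≡-Reasoning
    regroup : ∀ r p → ½ * r * (p * (1ℚ + 1ℚ)) ≡ r * p
    regroup = solve-∀ ℚ-ring

  -- Every light pair with an endpoint in `S` is charged to its other endpoint `x`. Only `x` in `S′`
  -- receive a nonzero charge, each at most its degree and hence at most `cap`; the scaling by
  -- `1/(2t)` turns `cap` into `1/n`.
  matching-gain : {S S′ : Fin n → Set} (S? : ∀ j → Dec (S j)) (S′? : ∀ x → Dec (S′ x)) →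
                  (∀ {e} → e ∈ E → S (query₁ e) → weight e ≡ 0ℚ ⊎ S′ (query₂ e)) →
                  (∀ {e} → e ∈ E → S (query₂ e) → weight e ≡ 0ℚ ⊎ S′ (query₁ e)) →
                  ∑ᶠ (λ j → 𝟙 (S? j) * D j) ≤ mean (λ x → 𝟙 (S′? x))
  matching-gain {S} {S′} S? S′? derive₁ derive₂ = begin
    ∑ᶠ (λ j → σ j * D j)
      ≡⟨ ∑-*D σ ⟩
    ½ * ρ * ∑ E (λ e → weight e * both e * (σ (query₁ e) + σ (query₂ e)))
      ≡⟨ cong (½ * ρ *_) spread ⟨
    ½ * ρ * ∑ᶠ y
      ≤⟨ *-monoˡ ½ρ≥0 (∑-mono (allFin n) y≤) ⟩
    ½ * ρ * ∑ᶠ (λ x → cap * 𝟙 (S′? x))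
      ≡⟨ cong (½ * ρ *_) (∑-*ˡ (allFin n) cap (λ x → 𝟙 (S′? x))) ⟩
    ½ * ρ * (cap * ∑ᶠ (λ x → 𝟙 (S′? x)))
      ≡⟨ trans (sym (*-assoc (½ * ρ) cap _)) (cong (_* ∑ᶠ (λ x → 𝟙 (S′? x))) ½ρ*cap) ⟩
    mean (λ x → 𝟙 (S′? x)) ∎
    where
    open ≤-Reasoning
    σ : Fin n → ℚ
    σ j = 𝟙 (S? j)
    term : Fin n → Run → ℚ
    term x e = weight e * both e * (σ (query₁ e) * δ (query₂ e) x + σ (query₂ e) * δ (query₁ e) x)
    y : Fin n → ℚ
    y x = ∑ E (term x)
    spread : ∑ᶠ y ≡ ∑ E (λ e → weight e * both e * (σ (query₁ e) + σ (query₂ e)))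
    spread = trans (∑-swap (allFin n) E term) (∑-cong E λ e →
      trans (∑-*ˡ (allFin n) (weight e * both e) (λ x → σ (query₁ e) * δ (query₂ e) x + σ (query₂ e) * δ (query₁ e) x))
      (cong (weight e * both e *_) (trans (∑-+ (allFin n) (λ x → σ (query₁ e) * δ (query₂ e) x) (λ x → σ (query₂ e) * δ (query₁ e) x))
        (cong₂ _+_ (∑-*δ (λ _ → σ (query₁ e)) (query₂ e)) (∑-*δ (λ _ → σ (query₂ e)) (query₁ e))))))
    y≤ : ∀ x → y x ≤ cap * 𝟙 (S′? x)
    y≤ x with S′? x
    ... | yes _ = ≤-trans (∑-mono-∈ E λ {e} e∈E → *-monoˡ (w*both≥0 e∈E) (≤-trans
            (+-mono-≤ (drop (query₁ e) (query₂ e)) (drop (query₂ e) (query₁ e))) (≤-reflexive (+-comm (δ (query₂ e) x) (δ (query₁ e) x)))))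
          (≤-trans (degree≤cap x) (≤-reflexive (sym (*-identityʳ cap))))
      where
      drop : ∀ a b → σ a * δ b x ≤ δ b x
      drop a b = ≤-trans (*-monoʳ (δ≥0 b x) (𝟙≤1 (S? a))) (≤-reflexive (*-identityˡ (δ b x)))
    ... | no ¬S′ = ≤-reflexive (trans (trans (∑-cong-∈ E vanish) (∑-zero E)) (sym (*-zeroʳ cap)))
      where
      zeros : ∀ {e} a b → (S a → weight e ≡ 0ℚ ⊎ S′ b) → weight e * (σ a * δ b x) ≡ 0ℚ
      zeros {e} a b derive with S? a | b Fin.≟ x
      ... | no _  | d        = trans (cong (weight e *_) (*-zeroˡ (𝟙 d))) (*-zeroʳ (weight e))
      ... | yes _ | no _     = *-zeroʳ (weight e)
      ... | yes p | yes refl with derive p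
      ...   | inj₁ w≡0 = trans (cong (_* (1ℚ * 1ℚ)) w≡0) (*-zeroˡ (1ℚ * 1ℚ))
      ...   | inj₂ s′  = contradiction s′ ¬S′
      distrib : ∀ w o a b → w * o * (a + b) ≡ o * (w * a + w * b)
      distrib = solve-∀ ℚ-ring
      vanish : ∀ {e} → e ∈ E → term x e ≡ 0ℚ
      vanish {e} e∈E = trans (distrib (weight e) (both e) (σ (query₁ e) * δ (query₂ e) x) (σ (query₂ e) * δ (query₁ e) x))
        (trans (cong (both e *_) (cong₂ _+_ (zeros {e} (query₁ e) (query₂ e) (derive₁ e∈E)) (zeros {e} (query₂ e) (query₁ e) (derive₂ e∈E))))
          (*-zeroʳ (both e)))

  -- Voting by single positions

  share : Fin n → Run → ℚ
  -- A run with exactly one light query is concentrated on that position with density `n`. A run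
  -- with two heavy queries sees only blanks and is spread evenly over all `x`. A light pair takes
  -- no part.
  share x e = N * (l a * (1ℚ - l b) * δ a x + (1ℚ - l a) * l b * δ b x) + (1ℚ - l a) * (1ℚ - l b)
    where
    a b : Fin n
    a = query₁ e
    b = query₂ e

  share≥0 : ∀ x e → 0ℚ ≤ share x e
  share≥0 x e = +-nonneg (*-nonneg (ι≥0 n) (+-nonneg
      (*-nonneg (*-nonneg (l≥0 (query₁ e)) (1-l≥0 (query₂ e))) (δ≥0 (query₁ e) x))
      (*-nonneg (*-nonneg (1-l≥0 (query₁ e)) (l≥0 (query₂ e))) (δ≥0 (query₂ e) x))))
    (*-nonneg (1-l≥0 (query₁ e)) (1-l≥0 (query₂ e)))

  mean-δ : ∀ (a : Fin n) → mean (δ a) ≡ ν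
  mean-δ a = trans (cong (ν *_) (∑-δ a)) (*-identityʳ ν)

  mean-share : ∀ e → mean (λ x → share x e) ≡ 1ℚ - both e
  mean-share e = begin
    mean (λ x → share x e)
      ≡⟨ mean-cong (λ x → regroup N (l a) (l b) (δ a x) (δ b x)) ⟩
    mean (λ x → N * l a * (1ℚ - l b) * δ a x + (N * (1ℚ - l a) * l b * δ b x + (1ℚ - l a) * (1ℚ - l b)))
      ≡⟨ mean-+ (λ x → N * l a * (1ℚ - l b) * δ a x) (λ x → N * (1ℚ - l a) * l b * δ b x + (1ℚ - l a) * (1ℚ - l b)) ⟩
    mean (λ x → N * l a * (1ℚ - l b) * δ a x) + mean (λ x → N * (1ℚ - l a) * l b * δ b x + (1ℚ - l a) * (1ℚ - l b))
      ≡⟨ cong₂ _+_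
           (trans (mean-*ˡ (N * l a * (1ℚ - l b)) (δ a)) (cong (N * l a * (1ℚ - l b) *_) (mean-δ a)))
           (trans (mean-+ (λ x → N * (1ℚ - l a) * l b * δ b x) (λ _ → (1ℚ - l a) * (1ℚ - l b)))
             (cong₂ _+_ (trans (mean-*ˡ (N * (1ℚ - l a) * l b) (δ b)) (cong (N * (1ℚ - l a) * l b *_) (mean-δ b)))
               (mean-const {n} ((1ℚ - l a) * (1ℚ - l b))))) ⟩
    N * l a * (1ℚ - l b) * ν + (N * (1ℚ - l a) * l b * ν + (1ℚ - l a) * (1ℚ - l b))
      ≡⟨ collect N ν (l a) (l b) ⟩
    N * ν * (l a * (1ℚ - l b) + (1ℚ - l a) * l b) + (1ℚ - l a) * (1ℚ - l b)
      ≡⟨ cong (λ z → z * (l a * (1ℚ - l b) + (1ℚ - l a) * l b) + (1ℚ - l a) * (1ℚ - l b)) (ι*recip n) ⟩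
    1ℚ * (l a * (1ℚ - l b) + (1ℚ - l a) * l b) + (1ℚ - l a) * (1ℚ - l b)
      ≡⟨ simplify (l a) (l b) ⟩
    1ℚ - both e ∎
    where
    open ≡-Reasoning
    a b : Fin n
    a = query₁ e
    b = query₂ e
    regroup : ∀ m p q x y → m * (p * (1ℚ - q) * x + (1ℚ - p) * q * y) + (1ℚ - p) * (1ℚ - q) ≡
              m * p * (1ℚ - q) * x + (m * (1ℚ - p) * q * y + (1ℚ - p) * (1ℚ - q))
    regroup = solve-∀ ℚ-ring
    collect : ∀ m v p q → m * p * (1ℚ - q) * v + (m * (1ℚ - p) * q * v + (1ℚ - p) * (1ℚ - q)) ≡
              m * v * (p * (1ℚ - q) + (1ℚ - p) * q) + (1ℚ - p) * (1ℚ - q)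
    collect = solve-∀ ℚ-ring
    simplify : ∀ p q → 1ℚ * (p * (1ℚ - q) + (1ℚ - p) * q) + (1ℚ - p) * (1ℚ - q) ≡ 1ℚ - p * q
    simplify = solve-∀ ℚ-ring

  -- The weighted shares at one position add up to at most `n` times the light load plus 1, hence to
  -- at most `2t + t`. The factor `1/(3t)` therefore keeps `turnout` at most 1.
  κ₀ : ℚ
  κ₀ = ⅓ * ρ

  κ₀≥0 : 0ℚ ≤ κ₀
  κ₀≥0 = *-nonneg (from-yes (0ℚ ≤? ⅓)) (recip≥0 t)

  g : Fin n → Run → ℚ
  g x e = κ₀ * (weight e * share x e)

  g≥0 : ∀ x {e} → e ∈ E → 0ℚ ≤ g x e
  g≥0 x {e} e∈E = *-nonneg κ₀≥0 (*-nonneg (w≥0 e∈E) (share≥0 x e))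

  vote : (Run → ℚ) → Fin n → ℚ
  vote f x = ∑ E (λ e → g x e * f e)

  mean-vote : ∀ f → mean (vote f) ≡ κ₀ * ∑ E (λ e → weight e * (1ℚ - both e) * f e)
  mean-vote f = trans (mean-∑ E (λ x e → g x e * f e)) (trans (∑-cong E inner)
    (∑-*ˡ E κ₀ (λ e → weight e * (1ℚ - both e) * f e)))
    where
    regroup : ∀ k w s f → k * (w * s) * f ≡ k * w * f * s
    regroup = solve-∀ ℚ-ring
    regroup′ : ∀ k w s f → k * w * f * s ≡ k * (w * s * f)
    regroup′ = solve-∀ ℚ-ring
    inner : ∀ e → mean (λ x → g x e * f e) ≡ κ₀ * (weight e * (1ℚ - both e) * f e)
    inner e = trans (mean-cong (λ x → regroup κ₀ (weight e) (share x e) (f e)))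
      (trans (mean-*ˡ (κ₀ * weight e * f e) (λ x → share x e))
      (trans (cong (κ₀ * weight e * f e *_) (mean-share e)) (regroup′ κ₀ (weight e) (1ℚ - both e) (f e))))

  turnout : Fin n → ℚ
  turnout = vote (λ _ → 1ℚ)

  turnout≤1 : ∀ x → turnout x ≤ 1ℚ
  turnout≤1 x = begin
    ∑ E (λ e → κ₀ * (weight e * share x e) * 1ℚ)
      ≡⟨ trans (∑-cong E (λ e → *-identityʳ (κ₀ * (weight e * share x e)))) (∑-*ˡ E κ₀ (λ e → weight e * share x e)) ⟩
    κ₀ * ∑ E (λ e → weight e * share x e)
      ≤⟨ *-monoˡ κ₀≥0 (∑-mono-∈ E (λ {e} e∈E → ≤-trans (*-monoˡ (w≥0 e∈E) (share≤ e)) (≤-reflexive (regroup N (weight e) (lδ e))))) ⟩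
    κ₀ * ∑ E (λ e → N * (weight e * lδ e) + weight e)
      ≡⟨ cong (κ₀ *_) (trans (∑-+ E (λ e → N * (weight e * lδ e)) weight) (cong₂ _+_ (∑-*ˡ E N (λ e → weight e * lδ e)) w-total)) ⟩
    κ₀ * (N * lightLoad x + 1ℚ)
      ≤⟨ *-monoˡ κ₀≥0 (+-mono-≤ (*-monoˡ (ι≥0 n) (lightLoad≤cap x)) 1≤t) ⟩
    κ₀ * (N * ((ι t + ι t) * ν) + ι t)
      ≡⟨ collect ρ N (ι t) ν ⟩
    ⅓ * (ι t * ρ) * ((N * ν) + (N * ν) + 1ℚ)
      ≡⟨ cong₂ (λ y z → ⅓ * y * (z + z + 1ℚ)) t*ρ≡1 (ι*recip n) ⟩
    1ℚ ∎
    where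
    open ≤-Reasoning
    lδ : Run → ℚ
    lδ e = l (query₁ e) * δ (query₁ e) x + l (query₂ e) * δ (query₂ e) x
    1≤t : 1ℚ ≤ ι t
    1≤t = subst (_≤ ι t) ι-1 (ι-mono (ℕ.>-nonZero⁻¹ t))
    regroup : ∀ m w d → w * (m * d + 1ℚ) ≡ m * (w * d) + w
    regroup = solve-∀ ℚ-ring
    collect : ∀ r m t v → ⅓ * r * (m * ((t + t) * v) + t) ≡ ⅓ * (t * r) * ((m * v) + (m * v) + 1ℚ)
    collect = solve-∀ ℚ-ring
    *≤ˡ : ∀ {p q} → 0ℚ ≤ p → q ≤ 1ℚ → p * q ≤ p
    *≤ˡ {p} 0≤p q≤1 = ≤-trans (*-monoˡ 0≤p q≤1) (≤-reflexive (*-identityʳ p))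
    1-l≤1 : ∀ j → 1ℚ - l j ≤ 1ℚ
    1-l≤1 j = ≤-by (l≥0 j) (cancel (l j))
      where
      cancel : ∀ x → 1ℚ ≡ 1ℚ - x + x
      cancel = solve-∀ ℚ-ring
    share≤ : ∀ e → share x e ≤ N * lδ e + 1ℚ
    share≤ e = +-mono-≤ (*-monoˡ (ι≥0 n) (+-mono-≤
        (*-monoʳ (δ≥0 (query₁ e) x) (*≤ˡ (l≥0 (query₁ e)) (1-l≤1 (query₂ e))))
        (*-monoʳ (δ≥0 (query₂ e) x) (≤-trans (*-monoʳ (l≥0 (query₂ e)) (1-l≤1 (query₁ e))) (≤-reflexive (*-identityˡ (l (query₂ e))))))))
      (≤-trans (*≤ˡ (1-l≥0 (query₁ e)) (1-l≤1 (query₂ e))) (1-l≤1 (query₁ e)))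

  -- The factor by which querying x changes the penalty of c: a vote for the symbol c i multiplies
  -- it by 1 - 1/5, a vote for another symbol by 1 + 1/4, averaged over the runs x takes part in.
  u : Word (suc s) n → Fin n → ℚ
  u c x = 1ℚ + ¼ * turnout x - c₀ * vote (hit c) x

  turnout≥0 : ∀ x → 0ℚ ≤ turnout x
  turnout≥0 x = ∑-nonneg-∈ E (λ e∈E → *-nonneg (g≥0 x e∈E) 0≤1)

  vote≥0 : ∀ c x → 0ℚ ≤ vote (hit c) x
  vote≥0 c x = ∑-nonneg-∈ E (λ {e} e∈E → *-nonneg (g≥0 x e∈E) (𝟙≥0 (output e (blanked c) Fin.≟ lookup c i)))

  u≥0 : ∀ c x → 0ℚ ≤ u c x
  u≥0 c x = ≤-trans (+-nonneg (+-nonneg (from-yes (0ℚ ≤? int 4 / 5)) (*-nonneg (from-yes (0ℚ ≤? int 1 / 5)) (diff≥0 (turnout≤1 x))))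
      (*-nonneg (from-yes (0ℚ ≤? c₀)) (diff≥0 p≤G)))
    (≤-reflexive (sym (regroup (turnout x) (vote (hit c) x))))
    where
    p≤G : vote (hit c) x ≤ turnout x
    p≤G = ∑-mono-∈ E (λ {e} e∈E → *-monoˡ (g≥0 x e∈E) (𝟙≤1 (output e (blanked c) Fin.≟ lookup c i)))
    regroup : ∀ G p → 1ℚ + int 1 / 4 * G - int 9 / 20 * p ≡ int 4 / 5 + int 1 / 5 * (1ℚ - G) + int 9 / 20 * (G - p)
    regroup = solve-∀ ℚ-ring

  -- Light pairs survive blanking and always decode correctly, so removing them leaves hits of mass
  -- at least `2/3 - lightPairs` among runs of mass `1 - lightPairs`. The worst case is
  -- `lightPairs = 1/6`, where `1/4 * 5/6 - 9/20 * 1/2 = -1/60`.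
  mean-u : lightPairs ≤ ⅙ → ∀ {c} → c ∈ C → mean (u c) ≤ 1ℚ - int 1 / 60 * κ₀
  mean-u few {c} c∈C = begin
    mean (u c)
      ≡⟨ mean-cong (λ x → minus (¼ * turnout x) c₀ (vote (hit c) x)) ⟩
    mean (λ x → 1ℚ + (¼ * turnout x + (- c₀) * vote (hit c) x))
      ≡⟨ trans (mean-+ (λ _ → 1ℚ) (λ x → ¼ * turnout x + (- c₀) * vote (hit c) x))
           (cong₂ _+_ (mean-const {n} 1ℚ) (trans (mean-+ (λ x → ¼ * turnout x) (λ x → (- c₀) * vote (hit c) x))
             (cong₂ _+_ (mean-*ˡ ¼ turnout) (mean-*ˡ (- c₀) (vote (hit c)))))) ⟩
    1ℚ + (¼ * mean turnout + (- c₀) * mean (vote (hit c)))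
      ≡⟨ cong₂ (λ y z → 1ℚ + (¼ * y + (- c₀) * z))
           (trans (mean-vote (λ _ → 1ℚ)) (cong (κ₀ *_) mass))
           (trans (mean-vote (hit c)) (cong (κ₀ *_) hit-mass)) ⟩
    1ℚ + (¼ * (κ₀ * (1ℚ - lightPairs)) + (- c₀) * (κ₀ * (H - lightPairs)))
      ≤⟨ ≤-by (*-nonneg κ₀≥0 (+-nonneg (*-nonneg (from-yes (0ℚ ≤? int 1 / 5)) (diff≥0 few))
            (*-nonneg (from-yes (0ℚ ≤? c₀)) (diff≥0 (hits c∈C)))))
           (collect κ₀ lightPairs H) ⟩
    1ℚ - int 1 / 60 * κ₀ ∎
    where
    open ≤-Reasoning
    H : ℚ
    H = ∑ E (λ e → weight e * hit c e)
    minus : ∀ a b v → 1ℚ + a - b * v ≡ 1ℚ + (a + (- b) * v)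
    minus = solve-∀ ℚ-ring
    collect : ∀ k p h → 1ℚ - int 1 / 60 * k ≡
      1ℚ + (int 1 / 4 * (k * (1ℚ - p)) + (- (int 9 / 20)) * (k * (h - p))) +
      k * (int 1 / 5 * (int 1 / 6 - p) + int 9 / 20 * (h - int 2 / 3))
    collect = solve-∀ ℚ-ring
    distrib : ∀ w o h → w * (1ℚ - o) * h ≡ w * h + (- 1ℚ) * (w * o * h)
    distrib = solve-∀ ℚ-ring
    split : ∀ f → ∑ E (λ e → weight e * (1ℚ - both e) * f e) ≡
            ∑ E (λ e → weight e * f e) - ∑ E (λ e → weight e * both e * f e)
    split f = trans (∑-cong E (λ e → distrib (weight e) (both e) (f e)))
      (trans (∑-+ E (λ e → weight e * f e) (λ e → (- 1ℚ) * (weight e * both e * f e)))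
        (trans (cong (∑ E (λ e → weight e * f e) +_) (∑-*ˡ E (- 1ℚ) (λ e → weight e * both e * f e)))
          (minus-one (∑ E (λ e → weight e * f e)) (∑ E (λ e → weight e * both e * f e)))))
      where
      minus-one : ∀ a b → a + (- 1ℚ) * b ≡ a - b
      minus-one = solve-∀ ℚ-ring
    mass : ∑ E (λ e → weight e * (1ℚ - both e) * 1ℚ) ≡ 1ℚ - lightPairs
    mass = trans (split (λ _ → 1ℚ)) (cong₂ _-_
      (trans (∑-cong E (λ e → *-identityʳ (weight e))) w-total) (∑-cong E (λ e → *-identityʳ (weight e * both e))))
    light-hit : ∀ {e} → e ∈ E → weight e * both e * hit c e ≡ weight e * both e
    light-hit {e} e∈E = decide (exact c∈C e∈E) (light? (query₁ e)) refl (light? (query₂ e)) refl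
      where
      decide : weight e ≡ 0ℚ ⊎ output e c ≡ lookup c i →
               (d₁ : Dec (Light (query₁ e))) → light? (query₁ e) ≡ d₁ →
               (d₂ : Dec (Light (query₂ e))) → light? (query₂ e) ≡ d₂ →
               weight e * both e * hit c e ≡ weight e * both e
      decide (inj₁ w≡0) _ _ _ _ = subst (λ w → w * both e * hit c e ≡ w * both e) (sym w≡0) (zeros (both e) (hit c e))
        where
        zeros : ∀ b h → 0ℚ * b * h ≡ 0ℚ * b
        zeros = solve-∀ ℚ-ring
      decide (inj₂ _) (no _) eq _ _ = subst (λ d → weight e * (𝟙 d * l (query₂ e)) * hit c e ≡ weight e * (𝟙 d * l (query₂ e))) (sym eq)
        (zeros (weight e) (l (query₂ e)) (hit c e))
        where
        zeros : ∀ w b h → w * (0ℚ * b) * h ≡ w * (0ℚ * b)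
        zeros = solve-∀ ℚ-ring
      decide (inj₂ _) (yes _) _ (no _) eq = subst (λ d → weight e * (l (query₁ e) * 𝟙 d) * hit c e ≡ weight e * (l (query₁ e) * 𝟙 d)) (sym eq)
        (zeros (weight e) (l (query₁ e)) (hit c e))
        where
        zeros : ∀ w a h → w * (a * 0ℚ) * h ≡ w * (a * 0ℚ)
        zeros = solve-∀ ℚ-ring
      decide (inj₂ out) (yes _) eq₁ (yes _) eq₂ = trans (cong (weight e * both e *_) (𝟙-yes (output e (blanked c) Fin.≟ lookup c i)
          (trans (cong₂ (proj₂ (proj₂ (proj₂ e))) (kept (query₁ e) eq₁) (kept (query₂ e) eq₂)) out)))
        (*-identityʳ (weight e * both e))
        where
        kept : ∀ j {p} → light? j ≡ yes p → lookup (blanked c) j ≡ lookup c j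
        kept j eq = trans (lookup∘tabulate (blank c) j) (cong (λ d → choose d (lookup c j) zero) eq)
    hit-mass : ∑ E (λ e → weight e * (1ℚ - both e) * hit c e) ≡ H - lightPairs
    hit-mass = trans (split (hit c)) (cong (λ z → H - z) (∑-cong-∈ E light-hit))

  -- A run taking part at `x` sees nothing but `x` and blanks, so it has the same output on both
  -- blanked words and is a hit for at most one of them. The factors `4/5` and `5/4` are reciprocal,
  -- and `turnout x ≤ 1` settles the averaged case through the term `G (1 - G)`.
  conflict : ∀ {c c′ x} → lookup c x ≡ lookup c′ x → lookup c i ≢ lookup c′ i → 1ℚ ≤ u c x * u c′ x
  conflict {c} {c′} {x} agree differ = ≤-by
    (+-nonneg (+-nonneg (*-nonneg (from-yes (0ℚ ≤? int 1 / 20)) (*-nonneg G≥0 (diff≥0 (turnout≤1 x))))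
      (*-nonneg (from-yes (0ℚ ≤? c₀)) (*-nonneg (+-nonneg 0≤1 (*-nonneg (from-yes (0ℚ ≤? ¼)) G≥0)) (diff≥0 disjoint))))
      (*-nonneg (from-yes (0ℚ ≤? c₀ * c₀)) (*-nonneg (vote≥0 c x) (vote≥0 c′ x))))
    (expand (turnout x) (vote (hit c) x) (vote (hit c′) x))
    where
    G≥0 : 0ℚ ≤ turnout x
    G≥0 = turnout≥0 x
    expand : ∀ G p p′ →
      (1ℚ + int 1 / 4 * G - int 9 / 20 * p) * (1ℚ + int 1 / 4 * G - int 9 / 20 * p′) ≡
      1ℚ + (int 1 / 20 * (G * (1ℚ - G)) + int 9 / 20 * ((1ℚ + int 1 / 4 * G) * (G - (p + p′)))
        + int 9 / 20 * (int 9 / 20) * (p * p′))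
    expand = solve-∀ ℚ-ring
    same : ∀ e → share x e ≡ 0ℚ ⊎ output e (blanked c) ≡ output e (blanked c′)
    same e = decide (light? a) refl (light? b) refl
      where
      a b : Fin n
      a = query₁ e
      b = query₂ e
      f : Fin (suc s) → Fin (suc s) → Fin (suc s)
      f = proj₂ (proj₂ (proj₂ e))
      at : ∀ w j {d} → light? j ≡ d → lookup (blanked w) j ≡ choose d (lookup w j) zero
      at w j eq = trans (lookup∘tabulate (blank w) j) (cong (λ d → choose d (lookup w j) zero) eq)
      erased : ∀ j {¬p} → light? j ≡ no ¬p → lookup (blanked c) j ≡ lookup (blanked c′) j
      erased j eq = trans (at c j eq) (sym (at c′ j eq))
      known : ∀ {j p} → light? j ≡ yes p → j ≡ x → lookup (blanked c) j ≡ lookup (blanked c′) j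
      known {j} eq refl = trans (at c j eq) (trans agree (sym (at c′ j eq)))
      Share : ℚ → ℚ → ℚ → ℚ → ℚ
      Share la lb da db = N * (la * (1ℚ - lb) * da + (1ℚ - la) * lb * db) + (1ℚ - la) * (1ℚ - lb)
      decide : (d₁ : Dec (Light a)) → light? a ≡ d₁ → (d₂ : Dec (Light b)) → light? b ≡ d₂ →
               share x e ≡ 0ℚ ⊎ output e (blanked c) ≡ output e (blanked c′)
      decide (no _)  eq₁ (no _)  eq₂ = inj₂ (cong₂ f (erased a eq₁) (erased b eq₂))
      decide (yes _) eq₁ (yes _) eq₂ = inj₁ (trans (cong₂ (λ d₁ d₂ → Share (𝟙 d₁) (𝟙 d₂) (δ a x) (δ b x)) eq₁ eq₂)
        (zeros N (δ a x) (δ b x)))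
        where
        zeros : ∀ m p q → m * (1ℚ * (1ℚ - 1ℚ) * p + (1ℚ - 1ℚ) * 1ℚ * q) + (1ℚ - 1ℚ) * (1ℚ - 1ℚ) ≡ 0ℚ
        zeros = solve-∀ ℚ-ring
      decide (yes _) eq₁ (no _)  eq₂ with a Fin.≟ x
      ... | yes a≡x = inj₂ (cong₂ f (known eq₁ a≡x) (erased b eq₂))
      ... | no  _   = inj₁ (trans (cong₂ (λ d₁ d₂ → Share (𝟙 d₁) (𝟙 d₂) 0ℚ (δ b x)) eq₁ eq₂) (zeros N (δ b x)))
        where
        zeros : ∀ m q → m * (1ℚ * (1ℚ - 0ℚ) * 0ℚ + (1ℚ - 1ℚ) * 0ℚ * q) + (1ℚ - 1ℚ) * (1ℚ - 0ℚ) ≡ 0ℚ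
        zeros = solve-∀ ℚ-ring
      decide (no _)  eq₁ (yes _) eq₂ with b Fin.≟ x
      ... | yes b≡x = inj₂ (cong₂ f (erased a eq₁) (known eq₂ b≡x))
      ... | no  _   = inj₁ (trans (cong₂ (λ d₁ d₂ → Share (𝟙 d₁) (𝟙 d₂) (δ a x) 0ℚ) eq₁ eq₂) (zeros N (δ a x)))
        where
        zeros : ∀ m p → m * (0ℚ * (1ℚ - 1ℚ) * p + (1ℚ - 0ℚ) * 1ℚ * 0ℚ) + (1ℚ - 0ℚ) * (1ℚ - 1ℚ) ≡ 0ℚ
        zeros = solve-∀ ℚ-ring
    one-hit : ∀ {o o′} → o ≡ o′ → 𝟙 (o Fin.≟ lookup c i) + 𝟙 (o′ Fin.≟ lookup c′ i) ≤ 1ℚ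
    one-hit {o} refl with o Fin.≟ lookup c i | o Fin.≟ lookup c′ i
    ... | yes p | yes q = contradiction (trans (sym p) q) differ
    ... | yes _ | no _  = ≤-refl
    ... | no _  | yes _ = ≤-refl
    ... | no _  | no _  = 0≤1
    disjoint : vote (hit c) x + vote (hit c′) x ≤ turnout x
    disjoint = ≤-trans (≤-reflexive (sym (∑-+ E (λ e → g x e * hit c e) (λ e → g x e * hit c′ e))))
      (∑-mono-∈ E pointwise)
      where
      pointwise : ∀ {e} → e ∈ E → g x e * hit c e + g x e * hit c′ e ≤ g x e * 1ℚ
      pointwise {e} e∈E = ≤-trans (≤-reflexive (sym (*-distribˡ-+ (g x e) (hit c e) (hit c′ e)))) (bound (same e))
        where
        bound : share x e ≡ 0ℚ ⊎ output e (blanked c) ≡ output e (blanked c′) →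
                g x e * (hit c e + hit c′ e) ≤ g x e * 1ℚ
        bound (inj₂ eq)   = *-monoˡ (g≥0 x e∈E) (one-hit eq)
        bound (inj₁ none) = ≤-reflexive (trans (vanish (hit c e + hit c′ e)) (sym (vanish 1ℚ)))
          where
          zeros : ∀ k w y → k * (w * 0ℚ) * y ≡ 0ℚ
          zeros = solve-∀ ℚ-ring
          vanish : ∀ y → g x e * y ≡ 0ℚ
          vanish y = trans (cong (λ z → κ₀ * (weight e * z) * y) none) (zeros κ₀ (weight e) y)

-- Counting words by a determining set of coordinates

Agree : ∀ {s n} → List (Fin n) → Word s n → Word s n → Set
Agree R c c′ = All (λ j → lookup c j ≡ lookup c′ j) R

agree? : ∀ {s n} R (c c′ : Word s n) → Dec (Agree R c c′)
agree? R c c′ = All.all? (λ j → lookup c j Fin.≟ lookup c′ j) R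

word-ext : ∀ {s n} {c c′ : Word s n} → (∀ k → lookup c k ≡ lookup c′ k) → c ≡ c′
word-ext {c = c} {c′} eq = trans (sym (tabulate∘lookup c)) (trans (tabulate-cong eq) (tabulate∘lookup c′))

lookup-injective : ∀ {A : Set} {xs : List A} → Unique xs → ∀ i j → List.lookup xs i ≡ List.lookup xs j → i ≡ j
lookup-injective (_ ∷ _)   zero    zero    eq = refl
lookup-injective (x∉ ∷ _)  zero    (suc j) eq = contradiction eq (All.lookup x∉ (∈-lookup j))
lookup-injective (x∉ ∷ _)  (suc i) zero    eq = contradiction (sym eq) (All.lookup x∉ (∈-lookup i))
lookup-injective (_ ∷ uxs) (suc i) (suc j) eq = cong suc (lookup-injective uxs i j eq)

-- Restriction to `R` is injective on `C`. Encoding restrictions as numbers below `s ^ length R`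
-- lets the pigeonhole principle rule out a longer list.
determined-count : ∀ {s n} {C : List (Word s n)} → Unique C → (R : List (Fin n)) →
                   (∀ {c c′} → c ∈ C → c′ ∈ C → Agree R c c′ → c ≡ c′) →
                   length C ℕ.≤ s ℕ.^ length R
determined-count {s} {n} {C} unique R determined = ℕ.≮⇒≥ λ few → clash (Fin.pigeonhole few code)
  where
  restrict : Fin (length C) → Fin (length R) → Fin s
  restrict i j = lookup (List.lookup C i) (List.lookup R j)
  code : Fin (length C) → Fin (s ℕ.^ length R)
  code i = Fin.funToFin (restrict i)
  clash : ¬ (∃ λ i → ∃ λ j → i Fin.< j × code i ≡ code j)
  clash (i , j , i<j , eq) = Fin.<⇒≢ i<j (lookup-injective unique i j
    (determined (∈-lookup i) (∈-lookup j) (All.tabulate agree)))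
    where
    at : ∀ k → restrict i k ≡ restrict j k
    at k = trans (sym (Fin.finToFun-funToFin (restrict i) k))
      (trans (cong (λ f → Fin.finToFun f k) eq) (Fin.finToFun-funToFin (restrict j) k))
    agree : ∀ {x} → x ∈ R → lookup (List.lookup C i) x ≡ lookup (List.lookup C j) x
    agree x∈R = subst (λ x → lookup (List.lookup C i) x ≡ lookup (List.lookup C j) x)
      (sym (lookup-index x∈R)) (at (index x∈R))

-- Binary logarithms

log≥1 : ∀ {n} → 2 ℕ.≤ n → 1 ℕ.≤ ⌈log₂ n ⌉
log≥1 {n} 2≤n = ℕ.≤-trans (ℕ.≤-reflexive (sym (⌈log₂2^n⌉≡n 1))) (⌈log₂⌉-mono-≤ {2} {n} 2≤n)

-- Strong induction: for `n ≥ 2`, halving with rounding up lowers the logarithm by exactly one.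
n≤2^⌈log₂n⌉ : ∀ n → n ℕ.≤ 2 ℕ.^ ⌈log₂ n ⌉
n≤2^⌈log₂n⌉ = <-rec _ step
  where
  step : ∀ n → (∀ {m} → m ℕ.< n → m ℕ.≤ 2 ℕ.^ ⌈log₂ m ⌉) → n ℕ.≤ 2 ℕ.^ ⌈log₂ n ⌉
  step zero          ih = ℕ.z≤n
  step (suc zero)    ih = ℕ.≤-refl
  step n@(suc (suc k)) ih = begin
    n                                    ≡⟨ ℕ.⌊n/2⌋+⌈n/2⌉≡n n ⟨
    ℕ.⌊ n /2⌋ ℕ.+ ℕ.⌈ n /2⌉              ≤⟨ ℕ.+-monoˡ-≤ ℕ.⌈ n /2⌉ (ℕ.⌊n/2⌋≤⌈n/2⌉ n) ⟩
    ℕ.⌈ n /2⌉ ℕ.+ ℕ.⌈ n /2⌉              ≡⟨ cong (ℕ.⌈ n /2⌉ ℕ.+_) (ℕ.+-identityʳ ℕ.⌈ n /2⌉) ⟨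
    2 ℕ.* ℕ.⌈ n /2⌉                      ≤⟨ ℕ.*-monoʳ-≤ 2 (ih (ℕ.⌈n/2⌉<n k)) ⟩
    2 ℕ.^ suc ⌈log₂ ℕ.⌈ n /2⌉ ⌉          ≡⟨ cong (λ e → 2 ℕ.^ suc e) (⌈log₂⌈n/2⌉⌉≡⌈log₂n⌉∸1 n) ⟩
    2 ℕ.^ (1 ℕ.+ (⌈log₂ n ⌉ ℕ.∸ 1))      ≡⟨ cong (2 ℕ.^_) (ℕ.m+[n∸m]≡n (log≥1 {n} (ℕ.s≤s (ℕ.s≤s ℕ.z≤n)))) ⟩
    2 ℕ.^ ⌈log₂ n ⌉                      ∎
    where open ℕ.≤-Reasoning

-- The decoder of a zero-error code

-- As `recip` is abstract, its values are identified through the equation that characterises them.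
recip-unique : ∀ q .{{_ : ℕ.NonZero q}} {y} → ι q * y ≡ 1ℚ → recip q ≡ y
recip-unique q {y} eq = trans (sym (*-identityʳ (recip q))) (trans (cong (recip q *_) (sym eq))
  (trans (swap (recip q) (ι q) y) (trans (cong (_* y) (ι*recip q)) (*-identityˡ y))))
  where
  swap : ∀ a b c → a * (b * c) ≡ b * a * c
  swap = solve-∀ ℚ-ring

module Code
  {s n t : ℕ} .{{_ : ℕ.NonZero n}} .{{_ : ℕ.NonZero t}}
  (C : List (Word (suc s) n)) (A : Decoder (suc s) n) (A-distr : ∀ i → IsDistribution (A i))
  (A-decodes : ∀ {c} → c ∈ C → ∀ z → ι (hamming z c) * ι t ≤ ι n → ∀ i → int 2 / 3 ≤ Pr (A i) z (lookup c i))
  (A-exact : ∀ {c} → c ∈ C → ∀ i → Pr (A i) c (lookup c i) ≡ 1ℚ)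
  where

  module At (i : Fin n) = Coordinate {s} {n} {t} C i (A i) (A-distr i)
    (λ c∈C z close → A-decodes c∈C z close i) (λ c∈C → A-exact c∈C i)

  private
    ρ y N : ℚ
    ρ = recip t
    -- The expected relative drop `1/60 * κ₀` of a penalty in `mean-u`, left unmultiplied so that
    -- the two agree by definition; its value is `1/(180 t)`.
    y = int 1 / 60 * (int 1 / 3 * ρ)
    N = ι n

    scale : ∀ k {a} → ι k * a ≡ 1ℚ → ι (k ℕ.* t) * (a * ρ) ≡ 1ℚ
    scale k {a} eq = trans (cong (_* (a * ρ)) (ι-* k t)) (trans (swap (ι k) (ι t) a ρ)
      (trans (cong₂ _*_ eq (ι*recip t)) refl))
      where
      swap : ∀ a b c d → a * b * (c * d) ≡ (a * c) * (b * d)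
      swap = solve-∀ ℚ-ring

    180t*y : ι (180 ℕ.* t) * y ≡ 1ℚ
    180t*y = trans (cong (ι (180 ℕ.* t) *_) (merge ρ)) (scale 180 (cong (_* (int 1 / 180)) (ι≡⟦⟧ 180)))
      where
      merge : ∀ r → int 1 / 60 * (int 1 / 3 * r) ≡ int 1 / 180 * r
      merge = solve-∀ ℚ-ring

    y≥0 : 0ℚ ≤ y
    y≥0 = *-nonneg (from-yes (0ℚ ≤? int 1 / 60)) (*-nonneg (from-yes (0ℚ ≤? int 1 / 3)) (recip≥0 t))

    y≤1 : y ≤ 1ℚ
    y≤1 = *-mono (from-yes (0ℚ ≤? int 1 / 60)) 0≤1 (from-yes (int 1 / 60 ≤? 1ℚ))
      (*-mono (from-yes (0ℚ ≤? int 1 / 3)) 0≤1 (from-yes (int 1 / 3 ≤? 1ℚ)) (recip≤1 t))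

  -- Penalties and the method of conditional expectations

  Votable : Fin n → Set
  Votable i = At.lightPairs i ≤ int 1 / 6

  votable? : ∀ i → Dec (Votable i)
  votable? i = At.lightPairs i ≤ᵈ (int 1 / 6)

  -- The estimator of the Chernoff argument: by `penalty-conflict`, two words that agree on `R` but
  -- not at `i` cannot both have a value below 1.
  penalty : Fin n → Word (suc s) n → List (Fin n) → ℚ
  penalty i c []      = 1ℚ
  penalty i c (x ∷ R) = At.u i c x * penalty i c R

  penalty≥0 : ∀ i c R → 0ℚ ≤ penalty i c R
  penalty≥0 i c []      = 0≤1
  penalty≥0 i c (x ∷ R) = *-nonneg (At.u≥0 i c x) (penalty≥0 i c R)

  penalty-conflict : ∀ {i c c′} R → Agree R c c′ → lookup c i ≢ lookup c′ i →
                     1ℚ ≤ penalty i c R * penalty i c′ R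
  penalty-conflict []      []            differ = ≤-refl
  penalty-conflict {i} {c} {c′} (x ∷ R) (eq ∷ agree) differ = ≤-trans
    (*-mono 0≤1 (*-nonneg (penalty≥0 i c R) (penalty≥0 i c′ R)) (At.conflict i {c} {c′} {x} eq differ) (penalty-conflict {i} {c} {c′} R agree differ))
    (≤-reflexive (swap (At.u i c x) (At.u i c′ x) (penalty i c R) (penalty i c′ R)))
    where
    swap : ∀ a b c d → a * b * (c * d) ≡ (a * c) * (b * d)
    swap = solve-∀ ℚ-ring

  totalPenalty : Word (suc s) n → List (Fin n) → ℚ
  totalPenalty c R = ∑ᶠ (λ i → 𝟙 (votable? i) * penalty i c R)

  Φ : List (Fin n) → ℚ
  Φ R = ∑ C (λ c → totalPenalty c R)

  -- Each summand shrinks in expectation by the factor `1 - y`, so by linearity one position serves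
  -- all codewords and all votable coordinates at once.
  Φ-step : ∀ R → ∃ λ x → Φ (x ∷ R) ≤ (1ℚ - y) * Φ R
  Φ-step R = pick-≤ {n} {(1ℚ - y) * Φ R} {λ x → Φ (x ∷ R)} (begin
    mean (λ x → Φ (x ∷ R))
      ≡⟨ mean-∑ C (λ x c → totalPenalty c (x ∷ R)) ⟩
    ∑ C (λ c → mean (λ x → totalPenalty c (x ∷ R)))
      ≡⟨ ∑-cong C (λ c → mean-∑ (allFin n) (λ x i → 𝟙 (votable? i) * (At.u i c x * penalty i c R))) ⟩
    ∑ C (λ c → ∑ᶠ (λ i → mean (λ x → 𝟙 (votable? i) * (At.u i c x * penalty i c R))))
      ≤⟨ ∑-mono-∈ C (λ c∈C → ∑-mono (allFin n) (pointwise c∈C)) ⟩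
    ∑ C (λ c → ∑ᶠ (λ i → (1ℚ - y) * (𝟙 (votable? i) * penalty i c R)))
      ≡⟨ trans (∑-cong C (λ c → ∑-*ˡ (allFin n) (1ℚ - y) (λ i → 𝟙 (votable? i) * penalty i c R)))
           (∑-*ˡ C (1ℚ - y) (λ c → totalPenalty c R)) ⟩
    (1ℚ - y) * Φ R ∎)
    where
    open ≤-Reasoning
    regroup : ∀ v a p → v * (a * p) ≡ v * p * a
    regroup = solve-∀ ℚ-ring
    bound : ∀ {c} → c ∈ C → ∀ i (d : Dec (Votable i)) →
            𝟙 d * penalty i c R * mean (At.u i c) ≤ (1ℚ - y) * (𝟙 d * penalty i c R)
    bound {c} c∈C i (yes few) = ≤-trans (*-monoˡ (*-nonneg 0≤1 (penalty≥0 i c R)) (At.mean-u i few c∈C))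
      (≤-reflexive (*-comm (1ℚ * penalty i c R) (1ℚ - y)))
    bound {c} c∈C i (no _) = ≤-reflexive (zeros (penalty i c R) (mean (At.u i c)) (1ℚ - y))
      where
      zeros : ∀ p m a → 0ℚ * p * m ≡ a * (0ℚ * p)
      zeros = solve-∀ ℚ-ring
    pointwise : ∀ {c} → c ∈ C → ∀ i →
                mean (λ x → 𝟙 (votable? i) * (At.u i c x * penalty i c R)) ≤ (1ℚ - y) * (𝟙 (votable? i) * penalty i c R)
    pointwise {c} c∈C i = ≤-trans (≤-reflexive (trans
        (mean-cong (λ x → regroup (𝟙 (votable? i)) (At.u i c x) (penalty i c R)))
        (mean-*ˡ (𝟙 (votable? i) * penalty i c R) (At.u i c))))
      (bound c∈C i (votable? i))

  Φ-greedy : ∀ T → ∃ λ R → length R ≡ T × Φ R ≤ pow (1ℚ - y) T * Φ []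
  Φ-greedy zero    = [] , refl , ≤-reflexive (sym (*-identityˡ (Φ [])))
  Φ-greedy (suc T) = proj₁ next ∷ R , cong suc (proj₁ (proj₂ rest)) , ≤-trans (proj₂ next)
      (≤-trans (*-monoˡ (diff≥0 y≤1) (proj₂ (proj₂ rest))) (≤-reflexive (sym (*-assoc (1ℚ - y) (pow (1ℚ - y) T) (Φ [])))))
    where
    rest : ∃ λ R → length R ≡ T × Φ R ≤ pow (1ℚ - y) T * Φ []
    rest = Φ-greedy T
    R : List (Fin n)
    R = proj₁ rest
    next : ∃ λ x → Φ (x ∷ R) ≤ (1ℚ - y) * Φ R
    next = Φ-step R

  Φ[]≤ : Φ [] ≤ ι (length C) * N
  Φ[]≤ = ≤-trans (∑-mono C (λ c → ≤-trans (∑-mono (allFin n) (λ i → ≤-trans (≤-reflexive (*-identityʳ (𝟙 (votable? i)))) (𝟙≤1 (votable? i))))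
      (≤-reflexive (trans (∑ᶠ-const {n} 1ℚ) (trans (*-identityʳ N) (sym (*-identityˡ N)))))))
    (≤-reflexive (trans (∑-*ʳ C N (λ _ → 1ℚ)) (cong (_* N) (∑-one C))))

  module _ (L : ℕ) (n≤2^L : n ℕ.≤ 2 ℕ.^ L) where

    private
      T : ℕ
      T = suc L ℕ.* (180 ℕ.* t)
      P : ℚ
      P = pow (1ℚ - y) T

    R₀ : List (Fin n)
    R₀ = proj₁ (Φ-greedy T)

    R₀-length : length R₀ ≡ suc L ℕ.* (180 ℕ.* t)
    R₀-length = proj₁ (proj₂ (Φ-greedy T))

    -- `Φ` starts at no more than `n` times the code size, and every `180 t` positions halve it.
    -- After `L + 1` halvings at most half the code size is left.
    2Φ≤ : Φ R₀ + Φ R₀ ≤ ι (length C)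
    2Φ≤ = begin
      Φ R₀ + Φ R₀                             ≤⟨ +-mono-≤ le le ⟩
      P * (M * N) + P * (M * N)               ≡⟨ regroup P M N ⟩
      M * ((N + N) * P)                       ≤⟨ *-monoˡ (ι≥0 (length C)) (≤-trans (*-monoʳ P≥0 2N≤) (decay y≥0 180t*y y≤1 (suc L))) ⟩
      M * 1ℚ                                  ≡⟨ *-identityʳ M ⟩
      M                                       ∎
      where
      open ≤-Reasoning
      M : ℚ
      M = ι (length C)
      P≥0 : 0ℚ ≤ P
      P≥0 = pow≥0 T (diff≥0 y≤1)
      le : Φ R₀ ≤ P * (M * N)
      le = ≤-trans (proj₂ (proj₂ (Φ-greedy T))) (*-monoˡ P≥0 Φ[]≤)
      2N≤ : N + N ≤ ι (2 ℕ.^ suc L)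
      2N≤ = ≤-trans (+-mono-≤ (ι-mono n≤2^L) (ι-mono n≤2^L)) (≤-reflexive (sym (trans (ι-* 2 (2 ℕ.^ L)) (ι-2 (ι (2 ℕ.^ L))))))
      regroup : ∀ p m n → p * (m * n) + p * (m * n) ≡ m * ((n + n) * p)
      regroup = solve-∀ ℚ-ring

    -- The half of the code on which all votes succeed

    Good : Word (suc s) n → Set
    Good c = ∀ i → Votable i → penalty i c R₀ < 1ℚ

    good? : ∀ c → Dec (Good c)
    good? c = Fin.all? (λ i → votable? i →-dec (penalty i c R₀ <ᵈ 1ℚ))

    C′ : List (Word (suc s) n)
    C′ = filter good? C

    C′⊆C : ∀ {c} → c ∈ C′ → c ∈ C
    C′⊆C c∈C′ = proj₁ (∈-filter⁻ good? {xs = C} c∈C′)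

    -- A codeword that is not `Good` contributes at least 1 to `Φ R₀`, and `Φ R₀` is at most half
    -- the size of `C`.
    C′-large : length C ℕ.≤ 2 ℕ.* length C′
    C′-large = ι-cancel (begin
      ι (length C)
        ≤⟨ ≤-by (+-nonneg (diff≥0 2Φ≤) (+-nonneg (diff≥0 most) (diff≥0 most))) (regroup (ι (length C)) (ι (length C′)) (Φ R₀)) ⟩
      ι (length C′) + ι (length C′)
        ≡⟨ trans (ι-* 2 (length C′)) (ι-2 (ι (length C′))) ⟨
      ι (2 ℕ.* length C′) ∎)
      where
      open ≤-Reasoning
      regroup : ∀ m m′ f → m′ + m′ ≡ m + ((m - (f + f)) + ((m′ + f - m) + (m′ + f - m)))
      regroup = solve-∀ ℚ-ring
      penalties≥0 : ∀ c i → 0ℚ ≤ 𝟙 (votable? i) * penalty i c R₀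
      penalties≥0 c i = *-nonneg (𝟙≥0 (votable? i)) (penalty≥0 i c R₀)
      bad : ∀ c (d : Dec (Good c)) → 1ℚ ≤ 𝟙 d + totalPenalty c R₀
      bad c (yes _) = ≤-by (∑-nonneg (allFin n) (penalties≥0 c)) refl
      bad c (no ¬good) = ≤-trans (heavy (Fin.¬∀⟶∃¬ n _ (λ i → votable? i →-dec (penalty i c R₀ <ᵈ 1ℚ)) ¬good))
        (≤-reflexive (sym (+-identityˡ (totalPenalty c R₀))))
        where
        heavy : (∃ λ i → ¬ (Votable i → penalty i c R₀ < 1ℚ)) → 1ℚ ≤ totalPenalty c R₀
        heavy (i , ¬light) = ≤-trans (large (votable? i)) (∑-∈-≤ (allFin n) (λ {j} _ → penalties≥0 c j) (∈-allFin i))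
          where
          large : (d : Dec (Votable i)) → 1ℚ ≤ 𝟙 d * penalty i c R₀
          large (yes v) = ≤-trans (≮⇒≥ (λ lt → ¬light (λ _ → lt))) (≤-reflexive (sym (*-identityˡ (penalty i c R₀))))
          large (no ¬v) = contradiction (λ v → contradiction v ¬v) ¬light
      most : ι (length C) ≤ ι (length C′) + Φ R₀
      most = begin
        ι (length C)                                        ≡⟨ ∑-one C ⟨
        ∑ C (λ _ → 1ℚ)                                      ≤⟨ ∑-mono C (λ c → bad c (good? c)) ⟩
        ∑ C (λ c → 𝟙 (good? c) + totalPenalty c R₀)         ≡⟨ ∑-+ C (λ c → 𝟙 (good? c)) (λ c → totalPenalty c R₀) ⟩
        ∑ C (λ c → 𝟙 (good? c)) + Φ R₀                      ≡⟨ cong (_+ Φ R₀) (∑-𝟙 good? C) ⟩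
        ι (length C′) + Φ R₀                                ∎

    vote-determines : ∀ {c c′} → c ∈ C′ → c′ ∈ C′ → Agree R₀ c c′ → ∀ {i} → Votable i → lookup c i ≡ lookup c′ i
    vote-determines {c} {c′} c∈ c′∈ agree {i} v = decide (lookup c i Fin.≟ lookup c′ i)
      where
      below : ∀ {c} → c ∈ C′ → penalty i c R₀ < 1ℚ
      below c∈ = proj₂ (∈-filter⁻ good? {xs = C} c∈) i v
      decide : Dec (lookup c i ≡ lookup c′ i) → lookup c i ≡ lookup c′ i
      decide (yes eq) = eq
      decide (no neq) = contradiction
        (≤-<-trans (≤-trans (penalty-conflict {i} {c} {c′} R₀ agree neq) (≤-trans
          (*-monoˡ (penalty≥0 i c R₀) (<⇒≤ (below c′∈))) (≤-reflexive (*-identityʳ (penalty i c R₀))))) (below c∈))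
        (<-irrefl refl)

    -- The closure system of determined coordinates

    K : List (Fin n) → Fin n → Set
    -- `R₀` is built in, so votable coordinates are determined from the start. Quantifying over the
    -- list `C′` makes `K` decidable.
    K R k = All (λ c → All (λ c′ → Agree (R ++ R₀) c c′ → lookup c k ≡ lookup c′ k) C′) C′

    K? : ∀ R k → Dec (K R k)
    K? R k = All.all? (λ c → All.all? (λ c′ → agree? (R ++ R₀) c c′ →-dec (lookup c k Fin.≟ lookup c′ k)) C′) C′

    determine : ∀ {R k} → (∀ {c c′} → c ∈ C′ → c′ ∈ C′ → Agree (R ++ R₀) c c′ → lookup c k ≡ lookup c′ k) → K R k
    determine f = All.tabulate (λ c∈ → All.tabulate (λ c′∈ → f c∈ c′∈))

    determined : ∀ {R k} → K R k → ∀ {c c′} → c ∈ C′ → c′ ∈ C′ → Agree (R ++ R₀) c c′ → lookup c k ≡ lookup c′ k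
    determined known c∈ c′∈ = All.lookup (All.lookup known c∈) c′∈

    K-here : ∀ {x R} → K (x ∷ R) x
    K-here {x} {R} = determine {x ∷ R} (λ _ _ agree → All.head agree)

    K-there : ∀ {x R k} → K R k → K (x ∷ R) k
    K-there {x} {R} known = determine {x ∷ R} (λ c∈ c′∈ agree → determined {R} known c∈ c′∈ (All.tail agree))

    K-vote : ∀ {R k} → Votable k → K R k
    K-vote {R} v = determine {R} (λ c∈ c′∈ agree → vote-determines c∈ c′∈ (All.++⁻ʳ R agree) v)

    -- By `exact`, a run of nonzero weight computes coordinate `k` of every codeword from the two
    -- symbols it reads.
    K-query : ∀ {R k e} → e ∈ A k → K R (query₁ e) → K R (query₂ e) → weight e ≡ 0ℚ ⊎ K R k
    K-query {R} {k} {e} e∈ k₁ k₂ with weight e ≟ 0ℚ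
    ... | yes w≡0 = inj₁ w≡0
    ... | no  w≢0 = inj₂ (determine {R} λ c∈ c′∈ agree → trans (sym (out c∈))
            (trans (cong₂ (proj₂ (proj₂ (proj₂ e))) (determined {R} k₁ c∈ c′∈ agree) (determined {R} k₂ c∈ c′∈ agree)) (out c′∈)))
      where
      out : ∀ {c} → c ∈ C′ → output e c ≡ lookup c k
      out c∈ with At.exact k (C′⊆C c∈) e∈
      ... | inj₁ w≡0 = contradiction w≡0 w≢0
      ... | inj₂ eq  = eq

    private
      q : ℕ
      -- Chosen so that `4/q = 1/(6t)`, the total matching degree that `D-total` guarantees once
      -- `lightPairs` exceeds `1/6`.
      q = 24 ℕ.* t
      instance
        q≢0 : ℕ.NonZero q
        q≢0 = ℕ.m*n≢0 24 t
      α≡ : recip q ≡ int 1 / 24 * ρ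
      α≡ = recip-unique q (scale 24 (cong (_* (int 1 / 24)) (ι≡⟦⟧ 24)))

    D-in : ∀ {R k} → ¬ K R k → (recip q + recip q) + (recip q + recip q) ≤ ∑ᶠ (At.D k)
    D-in {R} {k} ¬known = begin
      (recip q + recip q) + (recip q + recip q)   ≡⟨ cong (λ a → (a + a) + (a + a)) α≡ ⟩
      _                                           ≡⟨ quadruple ρ ⟩
      ρ * (int 1 / 6)                             ≤⟨ *-monoˡ (recip≥0 t) (<⇒≤ (≰⇒> (λ few → ¬known (K-vote {R} few)))) ⟩
      ρ * At.lightPairs k                         ≡⟨ At.D-total k ⟨
      ∑ᶠ (At.D k)                                 ∎
      where
      open ≤-Reasoning
      quadruple : ∀ r → (int 1 / 24 * r + int 1 / 24 * r) + (int 1 / 24 * r + int 1 / 24 * r) ≡ r * (int 1 / 6)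
      quadruple = solve-∀ ℚ-ring

    gain : ∀ {R k} → ¬ K R k → ∑ᶠ (λ j → 𝟙 (K? R j) * At.D k j) ≤ mean (λ x → 𝟙 (K? (x ∷ R) k))
    gain {R} {k} _ = At.matching-gain k {K R} {λ x → K (x ∷ R) k} (K? R) (λ x → K? (x ∷ R) k)
      (λ {e} e∈ k₁ → K-query {query₂ e ∷ R} e∈ (K-there {R = R} k₁) (K-here {R = R}))
      (λ {e} e∈ k₂ → K-query {query₁ e ∷ R} e∈ (K-here {R = R}) (K-there {R = R} k₂))

    spanning : ∃ λ R → length R ℕ.≤ suc L ℕ.* (q ℕ.* q) ℕ.+ q ℕ.* suc (suc (L ℕ.+ L) ℕ.* q) × (∀ k → K R k)
    spanning = Spanning.span {n} {q} K K? (λ {x} {R} → K-here {x} {R}) (λ {x} {R} → K-there {x} {R})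
      (λ j k → At.D k j) (λ j k → At.D≥0 k j) (λ j k → At.D≤ν k j)
      (λ {R} → D-in {R}) (λ {R} → gain {R}) L (ℕ.≤-trans (ℕ.s≤s (ℕ.s≤s ℕ.z≤n)) (ℕ.m≤m*n 24 t)) n≤2^L

    -- The factor 2 restores the words lost in passing to `C′`, on which `R ++ R₀` determines
    -- everything.
    code-size : Unique C → length C ℕ.≤
      2 ℕ.* suc s ℕ.^ ((suc L ℕ.* (q ℕ.* q) ℕ.+ q ℕ.* suc (suc (L ℕ.+ L) ℕ.* q)) ℕ.+ suc L ℕ.* (180 ℕ.* t))
    code-size unique = ℕ.≤-trans C′-large (ℕ.*-monoʳ-≤ 2 (ℕ.≤-trans
      (determined-count (Unique.filter⁺ good? unique) (R ++ R₀)
        (λ c∈ c′∈ agree → word-ext (λ k → determined {R} (proj₂ (proj₂ spanning) k) c∈ c′∈ agree)))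
      (ℕ.^-monoʳ-≤ (suc s) (ℕ.≤-trans (ℕ.≤-reflexive (length-++ R))
        (ℕ.+-mono-≤ (proj₁ (proj₂ spanning)) (ℕ.≤-reflexive R₀-length))))))
      where
      R : List (Fin n)
      R = proj₁ spanning

-- From the radius `τ` to the integer `t`, and the final constants

inverse-approx : ∀ {τ} → 0ℚ < τ → τ ≤ 1ℚ → ∃ λ t → 1ℚ ≤ ι t * τ × ι t * τ ≤ 1ℚ + 1ℚ
inverse-approx {τ} 0<τ τ≤1 = search (proj₁ (archimedean τ 0<τ)) (proj₂ (archimedean τ 0<τ))
  where
  search : ∀ b → 1ℚ ≤ ι b * τ → ∃ λ t → 1ℚ ≤ ι t * τ × ι t * τ ≤ 1ℚ + 1ℚ
  search zero    le = zero , le , ≤-trans (≤-reflexive (trans (cong (_* τ) ι-0) (*-zeroˡ τ))) (from-yes (0ℚ ≤? 1ℚ + 1ℚ))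
  -- The search descends until `b τ ≤ 1` while `(b + 1) τ ≥ 1`; adding `τ ≤ 1` then gives the upper
  -- bound 2.
  search (suc b) le with ≤-cases 1ℚ (ι b * τ)
  ... | inj₁ le′ = search b le′
  ... | inj₂ ge  = suc b , le , ≤-trans (≤-reflexive (trans (cong (_* τ) (trans (ι-+ 1 b) (cong (_+ ι b) ι-1))) (split (ι b) τ)))
                     (+-mono-≤ τ≤1 ge)
    where
    split : ∀ b t → (1ℚ + b) * t ≡ t + b * t
    split = solve-∀ ℚ-ring

-- Lower-order terms are absorbed using that `L`, `t` and `ℓ` are at least 1. The constant is
-- `1 + 2 * 24² + 4 * 24² + 2 * 180 = 3817`, with the leading 1 for the factor 2 in `code-size`.
exponent-bound : ∀ {L t ℓ} → 1 ℕ.≤ L → 1 ℕ.≤ t → 1 ℕ.≤ ℓ →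
  1 ℕ.+ ℓ ℕ.* (suc L ℕ.* (24 ℕ.* t ℕ.* (24 ℕ.* t)) ℕ.+ 24 ℕ.* t ℕ.* suc (suc (L ℕ.+ L) ℕ.* (24 ℕ.* t)) ℕ.+ suc L ℕ.* (180 ℕ.* t))
  ℕ.≤ 3817 ℕ.* (t ℕ.* t) ℕ.* L ℕ.* ℓ
exponent-bound {L} {t} {ℓ} 1≤L 1≤t 1≤ℓ = ℕ.≤-trans
  (ℕ.+-mono-≤ (ℕ.*-mono-≤ 1≤ℓ (ℕ.*-mono-≤ 1≤L (ℕ.*-mono-≤ 1≤t 1≤t)))
    (ℕ.*-monoʳ-≤ ℓ (ℕ.+-mono-≤
      (ℕ.+-mono-≤ (ℕ.*-monoˡ-≤ (24 ℕ.* t ℕ.* (24 ℕ.* t)) 1+L≤)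
        (ℕ.*-monoʳ-≤ (24 ℕ.* t) (ℕ.+-mono-≤
          (ℕ.*-mono-≤ 1≤L (ℕ.*-mono-≤ {1} {24} (ℕ.s≤s ℕ.z≤n) 1≤t))
          (ℕ.*-monoˡ-≤ (24 ℕ.* t) (ℕ.+-monoˡ-≤ (L ℕ.+ L) 1≤L)))))
      (ℕ.*-mono-≤ 1+L≤ (ℕ.*-monoʳ-≤ 180 (ℕ.≤-trans (ℕ.≤-reflexive (sym (ℕ.*-identityʳ t))) (ℕ.*-monoʳ-≤ t 1≤t)))))))
  (ℕ.≤-reflexive (collect L t ℓ))
  where
  1+L≤ : suc L ℕ.≤ L ℕ.+ L
  1+L≤ = ℕ.+-monoˡ-≤ L 1≤L
  collect : ∀ L t ℓ → ℓ ℕ.* (L ℕ.* (t ℕ.* t)) ℕ.+ ℓ ℕ.* ((L ℕ.+ L) ℕ.* (24 ℕ.* t ℕ.* (24 ℕ.* t)) ℕ.+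
    24 ℕ.* t ℕ.* (L ℕ.* (24 ℕ.* t) ℕ.+ (L ℕ.+ (L ℕ.+ L)) ℕ.* (24 ℕ.* t)) ℕ.+ (L ℕ.+ L) ℕ.* (180 ℕ.* (t ℕ.* t)))
    ≡ 3817 ℕ.* (t ℕ.* t) ℕ.* L ℕ.* ℓ
  collect = ℕ.solve-∀

size-bound : ∀ {s b} → 2 ℕ.* s ^ b ℕ.≤ 2 ^ (1 ℕ.+ ⌈log₂ s ⌉ ℕ.* b)
size-bound {s} {b} = ℕ.*-monoʳ-≤ 2 (ℕ.≤-trans (ℕ.^-monoˡ-≤ b (n≤2^⌈log₂n⌉ s)) (ℕ.≤-reflexive (ℕ.^-*-assoc 2 ⌈log₂ s ⌉ b)))

-- For `s ≤ 1` the logarithm of `s` is 0, so the exponent has to be 0 and the code may have at most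
-- one word.
trivial-alphabet : ∀ {s n} {C : List (Word s n)} → s ℕ.≤ 1 → Unique C → length C ℕ.≤ 1
trivial-alphabet s≤1 unique = determined-count unique [] (λ _ _ _ → word-ext (λ k → same s≤1 _ _))
  where
  same : ∀ {s} → s ℕ.≤ 1 → (a b : Fin s) → a ≡ b
  same (ℕ.s≤s ℕ.z≤n) zero zero = refl

module _ {s n : ℕ} {τ : ℚ} {C : List (Word (suc s) n)} {A : Decoder (suc s) n}
  (lcc : IsZeroErrorLCC τ C A) (0<τ : 0ℚ < τ) where

  open IsZeroErrorLCC lcc

  lcc-size : ∀ t .{{_ : ℕ.NonZero n}} .{{_ : ℕ.NonZero t}} → 2 ℕ.≤ n → 2 ℕ.≤ suc s → 1ℚ ≤ ι t * τ → Unique C →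
             length C ℕ.≤ 2 ^ (3817 ℕ.* (t ℕ.* t) ℕ.* ⌈log₂ n ⌉ ℕ.* ⌈log₂ suc s ⌉)
  lcc-size t 2≤n 2≤s 1≤tτ unique = ℕ.≤-trans
    (Code.code-size {s} {n} {t} C A distr decodes′ (λ {c} c∈C i → zeroError c c∈C i) ⌈log₂ n ⌉ (n≤2^⌈log₂n⌉ n) unique)
    (ℕ.≤-trans (size-bound {suc s}) (ℕ.^-monoʳ-≤ 2 (exponent-bound (log≥1 2≤n) (ℕ.>-nonZero⁻¹ t) (log≥1 2≤s))))
    where
    -- A Hamming distance `h` with `h t ≤ n` satisfies `h ≤ h t τ ≤ τ n`, so radius `1/t` lies
    -- within radius `τ`.
    decodes′ : ∀ {c} → c ∈ C → ∀ z → ι (hamming z c) * ι t ≤ ι n → ∀ i → int 2 / 3 ≤ Pr (A i) z (lookup c i)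
    decodes′ {c} c∈C z near = decodes c c∈C z (subst₂ (λ h m → h ≤ τ * m) (ι≡⟦⟧ (hamming z c)) (ι≡⟦⟧ n) (begin
      ι (hamming z c)                  ≡⟨ *-identityʳ (ι (hamming z c)) ⟨
      ι (hamming z c) * 1ℚ             ≤⟨ *-monoˡ (ι≥0 (hamming z c)) 1≤tτ ⟩
      ι (hamming z c) * (ι t * τ)      ≡⟨ regroup (ι (hamming z c)) (ι t) τ ⟩
      τ * (ι (hamming z c) * ι t)      ≤⟨ *-monoˡ (<⇒≤ 0<τ) near ⟩
      τ * ι n                          ∎))
      where
      open ≤-Reasoning
      regroup : ∀ h t a → h * (t * a) ≡ a * (h * t)
      regroup = solve-∀ ℚ-ring

-- The factor `t²` is paid for by `(t τ)² ≤ 4`, which is the source of the 4; the remaining `τ²` is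
-- at most 1.
exponent-scaled : ∀ {τ} t a L ℓ → 0ℚ ≤ τ → τ ≤ 1ℚ → ι t * τ ≤ 1ℚ + 1ℚ →
  ⟦ a ℕ.* (t ℕ.* t) ℕ.* L ℕ.* ℓ ⟧ * (τ * τ * τ * τ) ≤ ⟦ 4 ℕ.* a ⟧ * ⟦ L ⟧ * ⟦ ℓ ⟧
exponent-scaled {τ} t a L ℓ 0≤τ τ≤1 tτ≤2 = subst₂ _≤_
  (cong (_* (τ * τ * τ * τ)) (ι≡⟦⟧ (a ℕ.* (t ℕ.* t) ℕ.* L ℕ.* ℓ)))
  (cong₂ _*_ (cong₂ _*_ (ι≡⟦⟧ (4 ℕ.* a)) (ι≡⟦⟧ L)) (ι≡⟦⟧ ℓ)) (begin
  ι (a ℕ.* (t ℕ.* t) ℕ.* L ℕ.* ℓ) * (τ * τ * τ * τ)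
    ≡⟨ cong (_* (τ * τ * τ * τ)) (trans (ι-* (a ℕ.* (t ℕ.* t) ℕ.* L) ℓ) (cong (_* ι ℓ)
         (trans (ι-* (a ℕ.* (t ℕ.* t)) L) (cong (_* ι L) (trans (ι-* a (t ℕ.* t)) (cong (ι a *_) (ι-* t t))))))) ⟩
  ι a * (ι t * ι t) * ι L * ι ℓ * (τ * τ * τ * τ)
    ≡⟨ regroup (ι a) (ι t) (ι L) (ι ℓ) τ ⟩
  ι a * ι L * ι ℓ * ((ι t * τ) * (ι t * τ) * (τ * τ))
    ≤⟨ *-monoˡ (*-nonneg (*-nonneg (ι≥0 a) (ι≥0 L)) (ι≥0 ℓ)) (*-mono (*-nonneg tτ≥0 tτ≥0) 0≤1
         (*-mono {s = 1ℚ + 1ℚ} tτ≥0 (from-yes (0ℚ ≤? 1ℚ + 1ℚ)) tτ≤2 tτ≤2) (*-mono {s = 1ℚ} 0≤τ 0≤1 τ≤1 τ≤1)) ⟩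
  ι a * ι L * ι ℓ * ((1ℚ + 1ℚ) * (1ℚ + 1ℚ) * 1ℚ)
    ≡⟨ regroup′ (ι a) (ι L) (ι ℓ) ⟩
  (1ℚ + 1ℚ) * (1ℚ + 1ℚ) * ι a * ι L * ι ℓ
    ≡⟨ cong (λ z → z * ι a * ι L * ι ℓ) (ι≡⟦⟧ 4) ⟨
  ι 4 * ι a * ι L * ι ℓ
    ≡⟨ cong (λ z → z * ι L * ι ℓ) (ι-* 4 a) ⟨
  ι (4 ℕ.* a) * ι L * ι ℓ ∎)
  where
  open ≤-Reasoning
  tτ≥0 : 0ℚ ≤ ι t * τ
  tτ≥0 = *-nonneg (ι≥0 t) 0≤τ
  regroup : ∀ a t L l x → a * (t * t) * L * l * (x * x * x * x) ≡ a * L * l * ((t * x) * (t * x) * (x * x))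
  regroup = solve-∀ ℚ-ring
  regroup′ : ∀ a L l → a * L * l * ((1ℚ + 1ℚ) * (1ℚ + 1ℚ) * 1ℚ) ≡ (1ℚ + 1ℚ) * (1ℚ + 1ℚ) * a * L * l
  regroup′ = solve-∀ ℚ-ring

theorem3p2 : ∃ λ (K : ℕ) → ∀ (s n : ℕ) (τ : ℚ) (C : List (Word s n)) →
    n ≥ 2 → 0ℚ < τ → τ ≤ 1ℚ → Unique C → IsLCC τ C →
    ∃ λ (m : ℕ) → length C Data.Nat.≤ 2 ^ m ×
    ⟦ m ⟧ * (τ * τ * τ * τ) ≤ ⟦ K ⟧ * ⟦ ⌈log₂ n ⌉ ⟧ * ⟦ ⌈log₂ s ⌉ ⟧
theorem3p2 = 4 ℕ.* 3817 , bound
  where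
  Bound : ∀ {s n} → ℚ → List (Word s n) → Set
  Bound {s} {n} τ C = ∃ λ m → length C ℕ.≤ 2 ^ m ×
    ⟦ m ⟧ * (τ * τ * τ * τ) ≤ ⟦ 4 ℕ.* 3817 ⟧ * ⟦ ⌈log₂ n ⌉ ⟧ * ⟦ ⌈log₂ s ⌉ ⟧
  trivial : ∀ {s n τ} {C : List (Word s n)} → s ℕ.≤ 1 → 0ℚ ≤ τ → τ ≤ 1ℚ → Unique C → Bound τ C
  trivial {s} {n} {τ} s≤1 0≤τ τ≤1 unique = 0 , trivial-alphabet s≤1 unique ,
    exponent-scaled 0 3817 ⌈log₂ n ⌉ ⌈log₂ s ⌉ 0≤τ τ≤1
      (≤-trans (≤-reflexive (trans (cong (_* τ) ι-0) (*-zeroˡ τ))) (from-yes (0ℚ ≤? 1ℚ + 1ℚ)))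
  bound : ∀ (s n : ℕ) (τ : ℚ) (C : List (Word s n)) → n ≥ 2 → 0ℚ < τ → τ ≤ 1ℚ → Unique C → IsLCC τ C → Bound τ C
  bound zero       n τ C 2≤n 0<τ τ≤1 unique _ = trivial ℕ.z≤n (<⇒≤ 0<τ) τ≤1 unique
  bound (suc zero) n τ C 2≤n 0<τ τ≤1 unique _ = trivial (ℕ.s≤s ℕ.z≤n) (<⇒≤ 0<τ) τ≤1 unique
  bound s@(suc (suc _)) n@(suc _) τ C 2≤n 0<τ τ≤1 unique (A , lcc) = with-scale (inverse-approx 0<τ τ≤1)
    where
    with-scale : (∃ λ t → 1ℚ ≤ ι t * τ × ι t * τ ≤ 1ℚ + 1ℚ) → Bound τ C
    with-scale (zero , 1≤0 , _) = contradiction (≤-trans 1≤0 (≤-reflexive (trans (cong (_* τ) ι-0) (*-zeroˡ τ))))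
      (λ le → <-irrefl refl (<-≤-trans (from-yes (0ℚ <? 1ℚ)) le))
    with-scale (t@(suc _) , 1≤tτ , tτ≤2) = 3817 ℕ.* (t ℕ.* t) ℕ.* ⌈log₂ n ⌉ ℕ.* ⌈log₂ s ⌉ ,
      lcc-size lcc 0<τ t 2≤n (ℕ.s≤s (ℕ.s≤s ℕ.z≤n)) 1≤tτ unique ,
      exponent-scaled t 3817 ⌈log₂ n ⌉ ⌈log₂ s ⌉ (<⇒≤ 0<τ) τ≤1 tτ≤2
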